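{- Let $\Delta$ and $\chi$ be integers with $2\le \chi\le \Delta$. If $G$ is a graph with maximum degree $\Delta$ and chromatic number $\chi$, then $$\chi'_{inj}(G)\le (\chi-1)\lceil 27\Delta\ln\Delta\rceil.$$ In particular, if $G$ is bipartite (with maximum degree $\Delta\ge 2$), then $\chi'_{inj}(G)\le \lceil 27\Delta\ln\Delta\rceil$.
   Context: All graphs are finite and simple; $\ln$ is the natural logarithm. An edge coloring of a graph $G$ (not necessarily proper) is \emph{injective} if any two distinct edges $e,f$ receive distinct colors whenever either (i) $e$ and $f$ share no vertex and some edge of $G$ joins an endpoint of $e$ to an endpoint of $f$, or (ii) $e$ and $f$ lie in a common triangle of $G$. The injective chromatic index $\chi'_{inj}(G)$ is the minimum number of colors in an injective edge coloring of $G$. -}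

module Defs where

open import Data.Bool.Base using (Bool; true; false; T)
open import Data.Bool.Properties using (T?; T-irrelevant)
open import Data.Fin.Base as Fin using (Fin; zero; suc)
open import Data.Fin.Properties as Fin using (all?; any?)
open import Data.Integer.Base as ℤ using (ℤ; +_)
open import Data.Integer.Properties as ℤ using ()
open import Data.List.Base using (List; []; _∷_; length; map; filter; allFin; concatMap; lookup)
open import Data.List.Extrema.Nat using (max)
open import Data.List.Membership.Propositional using (_∈_; lose)
open import Data.List.Membership.Propositional.Properties using (∈-allFin; ∈-concatMap⁺)
open import Data.List.Relation.Unary.All as All using (All)
open import Data.List.Relation.Unary.Any as Any using (here)
open import Data.List.Relation.Unary.Any.Properties using (lookup-index)
open import Data.Nat.Base as ℕ using (ℕ; zero; suc; z≤n; s≤s)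
open import Data.Nat.Properties as ℕ using ()
open import Data.Product.Base using (Σ; ∃; ∃-syntax; Σ-syntax; _×_; _,_; proj₁; proj₂)
open import Data.Rational.Unnormalised.Base using (ℚᵘ; mkℚᵘ; *≤*; *≡*; 0ℚᵘ; _+_; _*_; _≤_; _≃_)
import Data.Rational.Unnormalised.Properties as ℚ
open import Data.Sum.Base using (_⊎_; inj₁; inj₂)
import Data.Vec.Functional as F
open import Function.Base using (id; _∘_)
open import Level using (0ℓ)
open import Relation.Binary.Definitions using (DecidableEquality)
open import Relation.Binary.PropositionalEquality
open import Relation.Nullary using (¬_; Dec; yes; no; contradiction)
open import Relation.Nullary.Decidable using (map′; _×-dec_; _⊎-dec_; _→-dec_; ¬?)
open import Relation.Unary using (Pred; Decidable)

------------------------------------------------------------------------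
-- Minima of decidable predicates on ℕ

IsLeast : Pred ℕ 0ℓ → ℕ → Set
IsLeast P m = P m × (∀ k → P k → m ℕ.≤ k)

find-least : {P : Pred ℕ 0ℓ} → Decidable P → ∀ b → P b → ∃ (IsLeast P)
find-least P? b pb with P? 0
... | yes p0 = 0 , p0 , λ _ _ → z≤n
... | no ¬p0 with b
...   | zero   = contradiction pb ¬p0
...   | suc b′ with find-least (P? ∘ suc) b′ pb
...     | m , pm , m-min = suc m , pm , λ where
            zero    p0 → contradiction p0 ¬p0
            (suc k) pk → s≤s (m-min k pk)

------------------------------------------------------------------------
-- Finite simple graphs

record Graph : Set where
  field
    order      : ℕ
    adj        : Fin order → Fin order → Bool
    adj-sym    : ∀ u v → adj u v ≡ adj v u
    adj-irrefl : ∀ u → adj u u ≡ false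

  V : Set
  V = Fin order

  infix 4 _~_
  _~_ : V → V → Set
  u ~ v = T (adj u v)

  degree : V → ℕ
  degree u = length (filter (λ v → T? (adj u v)) (allFin order))

  maxDegree : ℕ
  maxDegree = max 0 (map degree (allFin order))

  -- Each edge is listed once, with its endpoints in increasing order.
  record Edge : Set where
    constructor edge
    field
      src tgt  : V
      src<tgt  : src Fin.< tgt
      adjacent : src ~ tgt

  open Edge public

  infix 4 _∈ₑ_
  _∈ₑ_ : V → Edge → Set
  x ∈ₑ e = x ≡ src e ⊎ x ≡ tgt e

  ShareVertex : Edge → Edge → Set
  ShareVertex e f = ∃[ x ] (x ∈ₑ e × x ∈ₑ f)

  JoinedByEdge : Edge → Edge → Set
  JoinedByEdge e f = ∃[ x ] ∃[ y ] (x ∈ₑ e × y ∈ₑ f × x ~ y)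

  IsTriangle : V → V → V → Set
  IsTriangle x y z = x ~ y × y ~ z × x ~ z

  EdgeWithin : V → V → V → Edge → Set
  EdgeWithin x y z e = ∀ v → v ∈ₑ e → v ≡ x ⊎ v ≡ y ⊎ v ≡ z

  InCommonTriangle : Edge → Edge → Set
  InCommonTriangle e f =
    ∃[ x ] ∃[ y ] ∃[ z ] (IsTriangle x y z × EdgeWithin x y z e × EdgeWithin x y z f)

  Conflict : Edge → Edge → Set
  Conflict e f = (¬ ShareVertex e f × JoinedByEdge e f) ⊎ InCommonTriangle e f

  IsProper : ∀ {k} → (V → Fin k) → Set
  IsProper c = ∀ u v → u ~ v → c u ≢ c v

  IsInjective : ∀ {k} → (Edge → Fin k) → Set
  IsInjective c = ∀ e f → e ≢ f → Conflict e f → c e ≢ c f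

  Colourable : ℕ → Set
  Colourable k = Σ[ c ∈ (V → Fin k) ] IsProper c

  InjectivelyEdgeColourable : ℕ → Set
  InjectivelyEdgeColourable k = Σ[ c ∈ (Edge → Fin k) ] IsInjective c

  Bipartite : Set
  Bipartite = Σ[ side ∈ (V → Bool) ] (∀ u v → u ~ v → side u ≢ side v)

------------------------------------------------------------------------
-- Decidability of colourability; this makes the two chromatic parameters
-- total functions.

search : ∀ m {k} {P : Pred (Fin m → Fin k) 0ℓ} →
         (∀ {f g} → f ≗ g → P f → P g) → Decidable P → Dec (∃ P)
search zero    resp P? = map′ (λ p → _ , p) (λ (_ , p) → resp (λ ()) p) (P? λ ())
search (suc m) {P = P} resp P? =
  map′ (λ (x , f , p) → x F.∷ f , p)
       (λ (f , p) → f zero , f ∘ suc , resp (λ { zero → refl ; (suc _) → refl }) p)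
       (any? λ x → search m {P = λ f → P (x F.∷ f)}
                     (λ f≗g → resp λ { zero → refl ; (suc i) → f≗g i })
                     (λ f → P? (x F.∷ f)))

module _ (G : Graph) where
  open Graph G

  colourable? : Decidable Colourable
  colourable? k = search order
    (λ f≗g pf u v u~v gu≡gv → pf u v u~v (trans (f≗g u) (trans gu≡gv (sym (f≗g v)))))
    (λ c → all? λ u → all? λ v → T? (adj u v) →-dec ¬? (c u Fin.≟ c v))

  colourable-order : Colourable order
  colourable-order = id , λ { u .u u~u refl → subst T (adj-irrefl u) u~u }

  _≟ₑ_ : DecidableEquality Edge
  edge u v p q ≟ₑ edge u′ v′ p′ q′ with u Fin.≟ u′ | v Fin.≟ v′
  ... | yes refl | yes refl =
    yes (cong₂ (edge u v) (ℕ.<-irrelevant p p′) (T-irrelevant q q′))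
  ... | no u≢u′  | _        = no (u≢u′ ∘ cong src)
  ... | _        | no v≢v′  = no (v≢v′ ∘ cong tgt)

  edgesBetween : V → V → List Edge
  edgesBetween u v with u Fin.<? v | T? (adj u v)
  ... | yes p | yes q = edge u v p q ∷ []
  ... | _     | _     = []

  edges : List Edge
  edges = concatMap (λ u → concatMap (edgesBetween u) (allFin order)) (allFin order)

  ∈-edgesBetween : ∀ e → e ∈ edgesBetween (src e) (tgt e)
  ∈-edgesBetween (edge u v p q) with u Fin.<? v | T? (adj u v)
  ... | yes p′ | yes q′ = here (cong₂ (edge u v) (ℕ.<-irrelevant p p′) (T-irrelevant q q′))
  ... | no ¬p  | _      = contradiction p ¬p
  ... | yes _  | no ¬q  = contradiction q ¬q

  ∈-edges : ∀ e → e ∈ edges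
  ∈-edges e = ∈-concatMap⁺ (λ u → concatMap (edgesBetween u) (allFin order))
    (lose (∈-allFin (src e))
      (∈-concatMap⁺ (edgesBetween (src e)) (lose (∈-allFin (tgt e)) (∈-edgesBetween e))))

  edgeIndex : Edge → Fin (length edges)
  edgeIndex e = Any.index (∈-edges e)

  lookup-edgeIndex : ∀ e → e ≡ lookup edges (edgeIndex e)
  lookup-edgeIndex e = lookup-index (∈-edges e)

  allEdges? : {P : Pred Edge 0ℓ} → Decidable P → Dec (∀ e → P e)
  allEdges? P? = map′ (λ ps e → All.lookup ps (∈-edges e))
                      (λ p → All.tabulate (λ {e} _ → p e))
                      (All.all? P? edges)

  conflict? : ∀ e f → Dec (Conflict e f)
  conflict? e f =
    (¬? (any? λ x → (x ∈? e) ×-dec (x ∈? f)) ×-dec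
      (any? λ x → any? λ y → (x ∈? e) ×-dec (y ∈? f) ×-dec T? (adj x y)))
    ⊎-dec
    (any? λ x → any? λ y → any? λ z →
      (T? (adj x y) ×-dec T? (adj y z) ×-dec T? (adj x z)) ×-dec within? x y z e ×-dec within? x y z f)
    where
    _∈?_ : ∀ x e → Dec (x ∈ₑ e)
    x ∈? e = (x Fin.≟ src e) ⊎-dec (x Fin.≟ tgt e)

    within? : ∀ x y z e → Dec (EdgeWithin x y z e)
    within? x y z e = all? λ v →
      (v ∈? e) →-dec ((v Fin.≟ x) ⊎-dec (v Fin.≟ y) ⊎-dec (v Fin.≟ z))

  isInjective? : ∀ {k} (c : Edge → Fin k) → Dec (IsInjective c)
  isInjective? c = allEdges? λ e → allEdges? λ f →
    ¬? (e ≟ₑ f) →-dec (conflict? e f →-dec ¬? (c e Fin.≟ c f))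

  isInjective-resp : ∀ {k} {c d : Edge → Fin k} → c ≗ d → IsInjective c → IsInjective d
  isInjective-resp c≗d ic e f e≢f ef de≡df =
    ic e f e≢f ef (trans (c≗d e) (trans de≡df (sym (c≗d f))))

  injectivelyEdgeColourable? : Decidable InjectivelyEdgeColourable
  injectivelyEdgeColourable? k = map′
    (λ (g , ig) → g ∘ edgeIndex , ig)
    (λ (c , ic) → c ∘ lookup edges , isInjective-resp (λ e → cong c (lookup-edgeIndex e)) ic)
    (search (length edges)
      (λ f≗g → isInjective-resp (f≗g ∘ edgeIndex))
      (λ g → isInjective? (g ∘ edgeIndex)))

  injectivelyEdgeColourable-size : InjectivelyEdgeColourable (length edges)
  injectivelyEdgeColourable-size = edgeIndex , λ e f e≢f _ eq →
    e≢f (trans (lookup-edgeIndex e) (trans (cong (lookup edges) eq) (sym (lookup-edgeIndex f))))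

  chromaticNumber : ℕ
  chromaticNumber = proj₁ (find-least colourable? order colourable-order)

  chromaticNumber-isLeast : IsLeast Colourable chromaticNumber
  chromaticNumber-isLeast = proj₂ (find-least colourable? order colourable-order)

  injectiveChromaticIndex : ℕ
  injectiveChromaticIndex = proj₁
    (find-least injectivelyEdgeColourable? (length edges) injectivelyEdgeColourable-size)

  injectiveChromaticIndex-isLeast : IsLeast InjectivelyEdgeColourable injectiveChromaticIndex
  injectiveChromaticIndex-isLeast = proj₂
    (find-least injectivelyEdgeColourable? (length edges) injectivelyEdgeColourable-size)

------------------------------------------------------------------------
-- Real numbers as regular sequences of rationals (Bishop)

1/[1+_] : ℕ → ℚᵘ
1/[1+ n ] = mkℚᵘ (+ 1) n

fromℤᵘ : ℤ → ℚᵘ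
fromℤᵘ a = mkℚᵘ a 0

-- Since i and j range over both orders, `regular` is the usual condition
-- ∣ xᵢ - xⱼ ∣ ≤ 1/(i+1) + 1/(j+1).
record ℝ : Set where
  constructor mkℝ
  field
    approx  : ℕ → ℚᵘ
    regular : ∀ i j → approx i ≤ approx j + (1/[1+ i ] + 1/[1+ j ])

open ℝ public

infix 4 _≤ᴿ_
_≤ᴿ_ : ℝ → ℝ → Set
x ≤ᴿ y = ∀ i → approx x i ≤ approx y i + (1/[1+ i ] + 1/[1+ i ])

fromℤ : ℤ → ℝ
fromℤ a .approx  _   = fromℤᵘ a
fromℤ a .regular i j = ℚ.p≤p+q (fromℤᵘ a) (1/[1+ i ] + 1/[1+ j ])

scale-modulus : ∀ c i → fromℤᵘ (+ c) * 1/[1+ c ℕ.* suc i ] ≤ 1/[1+ i ]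
scale-modulus c i = *≤* (subst₂ ℤ._≤_ (sym lhs) (sym rhs) (ℤ.+≤+ (ℕ.n≤1+n (c ℕ.* suc i))))
  where
  lhs : (+ c ℤ.* + 1) ℤ.* + suc i ≡ + (c ℕ.* suc i)
  lhs = trans (cong (ℤ._* + suc i) (ℤ.*-identityʳ (+ c))) (sym (ℤ.pos-* c (suc i)))
  rhs : + 1 ℤ.* + (1 ℕ.* suc (c ℕ.* suc i)) ≡ + suc (c ℕ.* suc i)
  rhs = trans (ℤ.*-identityˡ _) (cong +_ (ℕ.*-identityˡ _))

-- Multiplication by a natural number; the sequence is reindexed so that it
-- stays regular.
infixr 7 _·_
_·_ : ℕ → ℝ → ℝ
(c · x) .approx  i   = fromℤᵘ (+ c) * approx x (c ℕ.* suc i)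
(c · x) .regular i j = begin
  c′ * approx x i′                                    ≤⟨ ℚ.*-monoʳ-≤-nonNeg c′ (regular x i′ j′) ⟩
  c′ * (approx x j′ + (1/[1+ i′ ] + 1/[1+ j′ ]))      ≃⟨ ℚ.*-distribˡ-+ c′ (approx x j′) (1/[1+ i′ ] + 1/[1+ j′ ]) ⟩
  c′ * approx x j′ + c′ * (1/[1+ i′ ] + 1/[1+ j′ ])   ≃⟨ ℚ.+-congʳ (c′ * approx x j′) (ℚ.*-distribˡ-+ c′ 1/[1+ i′ ] 1/[1+ j′ ]) ⟩
  c′ * approx x j′ + (c′ * 1/[1+ i′ ] + c′ * 1/[1+ j′ ])
    ≤⟨ ℚ.+-monoʳ-≤ (c′ * approx x j′) (ℚ.+-mono-≤ (scale-modulus c i) (scale-modulus c j)) ⟩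
  c′ * approx x j′ + (1/[1+ i ] + 1/[1+ j ])          ∎
  where
  open ℚ.≤-Reasoning
  c′ = fromℤᵘ (+ c)
  i′ = c ℕ.* suc i
  j′ = c ℕ.* suc j

-- m = ⌈ x ⌉ : the least integer m with x ≤ m.
IsCeiling : ℝ → ℤ → Set
IsCeiling x m = x ≤ᴿ fromℤ m × (∀ k → x ≤ᴿ fromℤ k → m ℤ.≤ k)

------------------------------------------------------------------------
-- The natural logarithm of a positive integer

-- harmonic m l = 1/(m+1) + ... + 1/(m+l)
harmonic : ℕ → ℕ → ℚᵘ
harmonic m zero    = 0ℚᵘ
harmonic m (suc l) = 1/[1+ m ] + harmonic (suc m) l

1/-anti : ∀ {m n} → m ℕ.≤ n → 1/[1+ n ] ≤ 1/[1+ m ]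
1/-anti m≤n = *≤* (ℤ.*-monoˡ-≤-nonNeg (+ 1) (ℤ.+≤+ (s≤s m≤n)))

suc/ : ∀ l K → mkℚᵘ (+ suc l) K ≃ 1/[1+ K ] + mkℚᵘ (+ l) K
suc/ l K = *≡* (begin
  + suc l ℤ.* (+ d ℤ.* + d)                     ≡⟨ sym (ℤ.*-assoc (+ suc l) (+ d) (+ d)) ⟩
  + suc l ℤ.* + d ℤ.* + d                       ≡⟨ cong (ℤ._* + d) (ℤ.*-distribʳ-+ (+ d) (+ 1) (+ l)) ⟩
  (+ 1 ℤ.* + d ℤ.+ + l ℤ.* + d) ℤ.* + d         ∎)
  where
  open ≡-Reasoning
  d = suc K

unit : ∀ t a → mkℚᵘ (+ suc a) (a ℕ.+ t ℕ.* suc a) ≃ 1/[1+ t ]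
unit t a = *≡* (trans (sym (ℤ.pos-* (suc a) (suc t)))
               (trans (cong +_ (ℕ.*-comm (suc a) (suc t))) (sym (ℤ.*-identityˡ _))))

harmonic-≥ : ∀ m l K → m ℕ.+ l ℕ.≤ suc K → mkℚᵘ (+ l) K ≤ harmonic m l
harmonic-≥ m zero    K _ = ℚ.≤-reflexive (*≡* refl)
harmonic-≥ m (suc l) K h = ℚ.≤-trans (ℚ.≤-reflexive (suc/ l K))
  (ℚ.+-mono-≤ (1/-anti (ℕ.≤-trans (ℕ.m≤m+n m l) (ℕ.≤-pred h′))) (harmonic-≥ (suc m) l K h′))
  where
  h′ : suc m ℕ.+ l ℕ.≤ suc K
  h′ = subst (ℕ._≤ suc K) (ℕ.+-suc m l) h

harmonic-≤ : ∀ m l K → K ℕ.≤ m → harmonic m l ≤ mkℚᵘ (+ l) K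
harmonic-≤ m zero    K _ = ℚ.≤-reflexive (*≡* refl)
harmonic-≤ m (suc l) K h = ℚ.≤-trans
  (ℚ.+-mono-≤ (1/-anti h) (harmonic-≤ (suc m) l K (ℕ.m≤n⇒m≤1+n h)))
  (ℚ.≤-reflexive (ℚ.≃-sym (suc/ l K)))

harmonic-+ : ∀ m l l′ → harmonic m (l ℕ.+ l′) ≃ harmonic m l + harmonic (l ℕ.+ m) l′
harmonic-+ m zero    l′ = ℚ.≃-sym (ℚ.+-identityˡ _)
harmonic-+ m (suc l) l′ = ℚ.≃-trans
  (ℚ.+-congʳ 1/[1+ m ] (subst (λ n → harmonic (suc m) (l ℕ.+ l′) ≃ harmonic (suc m) l + harmonic n l′)
                              (ℕ.+-suc l m) (harmonic-+ (suc m) l l′)))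
  (ℚ.≃-sym (ℚ.+-assoc 1/[1+ m ] (harmonic (suc m) l) (harmonic (suc (l ℕ.+ m)) l′)))

refine-≥ : ∀ a m l → harmonic m l ≤ harmonic (m ℕ.* suc a) (l ℕ.* suc a)
refine-≥ a m zero    = ℚ.≤-refl
refine-≥ a m (suc l) = ℚ.≤-trans
  (ℚ.+-mono-≤
    (ℚ.≤-trans (ℚ.≤-reflexive (ℚ.≃-sym (unit m a)))
      (harmonic-≥ (m ℕ.* suc a) (suc a) _ (ℕ.≤-reflexive (ℕ.+-comm (m ℕ.* suc a) (suc a)))))
    (refine-≥ a (suc m) l))
  (ℚ.≤-reflexive (ℚ.≃-sym (harmonic-+ (m ℕ.* suc a) (suc a) (l ℕ.* suc a))))

refine-≤ : ∀ b m l → harmonic (suc m ℕ.* suc b) (l ℕ.* suc b) ≤ harmonic m l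
refine-≤ b m zero    = ℚ.≤-refl
refine-≤ b m (suc l) = ℚ.≤-trans
  (ℚ.≤-reflexive (harmonic-+ (suc m ℕ.* suc b) (suc b) (l ℕ.* suc b)))
  (ℚ.+-mono-≤
    (ℚ.≤-trans (harmonic-≤ (suc m ℕ.* suc b) (suc b) _ (ℕ.n≤1+n _)) (ℚ.≤-reflexive (unit m b)))
    (refine-≤ b (suc m) l))

harmonic-shift : ∀ m l → harmonic m l ≤ 1/[1+ m ] + harmonic (suc m) l
harmonic-shift m zero    = *≤* (ℤ.+≤+ z≤n)
harmonic-shift m (suc l) = ℚ.+-monoʳ-≤ 1/[1+ m ] (harmonic-shift (suc m) l)

-- ln n = ∫₁ⁿ dt/t. The i-th approximation is the lower Riemann sum with
-- mesh 1/(i+1), which is Σ 1/t over i+1 < t ≤ n(i+1). The value at n = 0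
-- is a dummy.
ln : ℕ → ℝ
ln n .approx  i   = harmonic (suc i) (ℕ.pred n ℕ.* suc i)
ln n .regular i j = begin
  harmonic b (p ℕ.* b)                       ≤⟨ refine-≥ j b (p ℕ.* b) ⟩
  harmonic (b ℕ.* a) (p ℕ.* b ℕ.* a)         ≡⟨ cong₂ harmonic (ℕ.*-comm b a) swap ⟩
  harmonic (a ℕ.* b) (p ℕ.* a ℕ.* b)         ≤⟨ refine-≤ i j (p ℕ.* a) ⟩
  harmonic j (p ℕ.* a)                       ≤⟨ harmonic-shift j (p ℕ.* a) ⟩
  1/[1+ j ] + harmonic a (p ℕ.* a)           ≃⟨ ℚ.+-comm 1/[1+ j ] (harmonic a (p ℕ.* a)) ⟩
  harmonic a (p ℕ.* a) + 1/[1+ j ]           ≤⟨ ℚ.+-monoʳ-≤ (harmonic a (p ℕ.* a)) (ℚ.p≤q+p 1/[1+ j ] 1/[1+ i ]) ⟩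
  harmonic a (p ℕ.* a) + (1/[1+ i ] + 1/[1+ j ]) ∎
  where
  open ℚ.≤-Reasoning
  p = ℕ.pred n
  a = suc j
  b = suc i
  swap : p ℕ.* b ℕ.* a ≡ p ℕ.* a ℕ.* b
  swap = trans (ℕ.*-assoc p b a) (trans (cong (p ℕ.*_) (ℕ.*-comm b a)) (sym (ℕ.*-assoc p a b)))

{-# OPTIONS --safe #-}
-- Let V₀, …, Vᵣ be the classes of a proper colouring, and let group g consist of
-- the edges ab with b ∈ V_{g+1} (the leaf) and a ∈ A := V₀ ∪ … ∪ V_g (the centre).
-- Give every vertex v a vector h(v) of T = 2⌊log₂ Δ⌋ + 4 labels out of 4(Δ-1), and
-- colour ab by (g , t , h(a)ₜ) for some t such that h(a)ₜ differs from h(x)ₜ for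
-- every x ∈ A ∖ {a} adjacent to a or b.  Leaves of one group are independent, so
-- two conflicting edges of the group have such an x as the centre of one of them,
-- and they get different colours.
--
-- Such an h exists by the local lemma: there are at most 2(Δ-1) blockers x, so
-- resampling h(a) alone shows that ab has no admissible t with probability at
-- most 2^{-T}, and h(a) matters to at most Δ² ≤ 2^T / 4 edges of the group.
-- Finally ln Δ ≥ (5/8) ⌊log₂ Δ⌋ gives 4(Δ-1) T ≤ ⌈27 Δ ln Δ⌉.
module Submission where

open import Data.Bool.Base using (Bool; true; false; T)
open import Data.Bool.Properties using (T?; T-irrelevant)
open import Data.Fin.Base as Fin using (Fin; zero; suc; combine; inject≤)
import Data.Fin.Properties as Fin
open import Data.Integer.Base as ℤ using (+_)
import Data.Integer.Properties as ℤ
open import Data.List.Base using (List; []; _∷_; _++_; length; map; filter; allFin; cartesianProduct; cartesianProductWith)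
open import Data.List.Extrema.Nat using (xs≤max)
open import Data.List.Membership.Propositional using (_∈_; find; lose)
open import Data.List.Membership.Propositional.Properties using (∈-allFin; ∈-map⁺; ∈-filter⁺; ∈-filter⁻; ∈-cartesianProduct⁺; ∈-cartesianProductWith⁺)
open import Data.List.Properties using (map-++; length-map; length-tabulate)
open import Data.List.Relation.Unary.All as All using (All; []; _∷_)
import Data.List.Relation.Unary.All.Properties as All
open import Data.List.Relation.Unary.Any as Any using (Any; here; there)
import Data.List.Relation.Unary.Any.Properties as Any
open import Data.List.Relation.Unary.Unique.Propositional using (Unique; []; _∷_)
open import Data.List.Relation.Unary.Unique.Propositional.Properties using (allFin⁺)
open import Data.Nat.Base using (ℕ; zero; suc; _+_; _*_; _∸_; _^_; _≤_; _<_; z≤n; s≤s; >-nonZero)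
open import Data.Nat.ListAction using (sum)
open import Data.Nat.ListAction.Properties using (sum-++)
open import Data.Nat.Properties
open import Data.Nat.Tactic.RingSolver using (solve-∀)
open import Data.Product.Base using (∃; _×_; _,_; proj₁; proj₂)
open import Data.Rational.Unnormalised.Base as ℚ using (mkℚᵘ; *≤*)
import Data.Rational.Unnormalised.Properties as ℚ
open import Data.Sum.Base using (_⊎_; inj₁; inj₂)
open import Data.Vec.Base using (Vec; []; _∷_; lookup; _[_]≔_; replicate)
open import Data.Vec.Properties using (lookup∘update; lookup∘update′)
open import Function.Base using (_∘_; id)
open import Relation.Binary.Definitions using (tri<; tri≈; tri>)
open import Relation.Binary.PropositionalEquality
open import Relation.Nullary using (¬_; Dec; yes; no; contradiction)
open import Relation.Nullary.Decidable using (_×-dec_; _⊎-dec_; ¬?)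
open import Relation.Unary using (Decidable)
open import Defs

-- Finite sums and indicators

private variable
  A B C P Q : Set

∑ : List A → (A → ℕ) → ℕ
∑ xs f = sum (map f xs)

∑-mono : ∀ (xs : List A) {f g} → (∀ x → f x ≤ g x) → ∑ xs f ≤ ∑ xs g
∑-mono []       f≤g = z≤n
∑-mono (x ∷ xs) f≤g = +-mono-≤ (f≤g x) (∑-mono xs f≤g)

∑-cong : ∀ (xs : List A) {f g} → (∀ x → f x ≡ g x) → ∑ xs f ≡ ∑ xs g
∑-cong []       f≡g = refl
∑-cong (x ∷ xs) f≡g = cong₂ _+_ (f≡g x) (∑-cong xs f≡g)

∑-+ : ∀ (xs : List A) f g → ∑ xs (λ x → f x + g x) ≡ ∑ xs f + ∑ xs g
∑-+ []       f g = refl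
∑-+ (x ∷ xs) f g rewrite ∑-+ xs f g = shuffle (f x) (g x) (∑ xs f) (∑ xs g)
  where
  shuffle : ∀ a b c d → a + b + (c + d) ≡ a + c + (b + d)
  shuffle = solve-∀

∑-*ˡ : ∀ (xs : List A) c f → ∑ xs (λ x → c * f x) ≡ c * ∑ xs f
∑-*ˡ []       c f = sym (*-zeroʳ c)
∑-*ˡ (x ∷ xs) c f = trans (cong (_+_ (c * f x)) (∑-*ˡ xs c f)) (sym (*-distribˡ-+ c (f x) (∑ xs f)))

∑-*ʳ : ∀ (xs : List A) c f → ∑ xs (λ x → f x * c) ≡ ∑ xs f * c
∑-*ʳ xs c f = trans (∑-cong xs (λ x → *-comm (f x) c)) (trans (∑-*ˡ xs c f) (*-comm c (∑ xs f)))

∑-const : ∀ (xs : List A) c → ∑ xs (λ _ → c) ≡ length xs * c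
∑-const []       c = refl
∑-const (x ∷ xs) c = cong (_+_ c) (∑-const xs c)

∑-swap : ∀ (xs : List A) (ys : List B) (f : A → B → ℕ) →
         ∑ xs (λ x → ∑ ys (f x)) ≡ ∑ ys (λ y → ∑ xs (λ x → f x y))
∑-swap []       ys f = sym (trans (∑-const ys 0) (*-zeroʳ (length ys)))
∑-swap (x ∷ xs) ys f = trans (cong (_+_ (∑ ys (f x))) (∑-swap xs ys f))
                             (sym (∑-+ ys (f x) (λ y → ∑ xs (λ x → f x y))))

∑-++ : ∀ (xs ys : List A) f → ∑ (xs ++ ys) f ≡ ∑ xs f + ∑ ys f
∑-++ xs ys f = trans (cong sum (map-++ f xs ys)) (sum-++ (map f xs) (map f ys))

∑-map : ∀ (g : A → B) xs f → ∑ (map g xs) f ≡ ∑ xs (f ∘ g)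
∑-map g []       f = refl
∑-map g (x ∷ xs) f = cong (_+_ (f (g x))) (∑-map g xs f)

∑-cartesianProductWith : ∀ (g : A → B → C) xs ys f →
  ∑ (cartesianProductWith g xs ys) f ≡ ∑ xs (λ x → ∑ ys (λ y → f (g x y)))
∑-cartesianProductWith g []       ys f = refl
∑-cartesianProductWith g (x ∷ xs) ys f = trans (∑-++ (map (g x) ys) _ f)
  (cong₂ _+_ (∑-map (g x) ys f) (∑-cartesianProductWith g xs ys f))

∑-witness : ∀ (xs : List A) f → 0 < ∑ xs f → ∃ λ x → 0 < f x
∑-witness (x ∷ xs) f 0<∑ with f x in eq
... | suc _ = x , subst (0 <_) (sym eq) (s≤s z≤n)
... | zero  = ∑-witness xs f 0<∑

∈⇒≤∑ : ∀ {xs : List A} f {x} → x ∈ xs → f x ≤ ∑ xs f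
∈⇒≤∑ f (here refl)         = m≤m+n (f _) _
∈⇒≤∑ f (there {x = y} x∈xs) = ≤-trans (∈⇒≤∑ f x∈xs) (m≤n+m _ (f y))

⟦_⟧ : Dec P → ℕ
⟦ yes _ ⟧ = 1
⟦ no  _ ⟧ = 0

⟦⟧-≤ : ∀ (p : Dec P) {n} → (P → 1 ≤ n) → ⟦ p ⟧ ≤ n
⟦⟧-≤ (yes p) 1≤n = 1≤n p
⟦⟧-≤ (no _)  1≤n = z≤n

⟦⟧-true : ∀ (p : Dec P) → P → 1 ≤ ⟦ p ⟧
⟦⟧-true (yes _) _ = ≤-refl
⟦⟧-true (no ¬p) p = contradiction p ¬p

⟦⟧-mono : ∀ (p : Dec P) (q : Dec Q) → (P → Q) → ⟦ p ⟧ ≤ ⟦ q ⟧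
⟦⟧-mono p q f = ⟦⟧-≤ p (⟦⟧-true q ∘ f)

⟦⟧-witness : ∀ (p : Dec P) → 0 < ⟦ p ⟧ → P
⟦⟧-witness (yes p) _ = p

length-filter-∑ : ∀ {P : A → Set} (P? : Decidable P) xs → length (filter P? xs) ≡ ∑ xs (λ x → ⟦ P? x ⟧)
length-filter-∑ P? [] = refl
length-filter-∑ P? (x ∷ xs) with P? x
... | yes _ = cong suc (length-filter-∑ P? xs)
... | no  _ = length-filter-∑ P? xs

-- The local lemma

module LocalLemma
  {Ω I : Set} (ωs : List Ω)
  {Bad : I → Ω → Set} (bad? : ∀ i ω → Dec (Bad i ω))
  {Near : I → I → Set} (near? : ∀ i j → Dec (Near i j))
  where

  Avoids : List I → Ω → Set
  Avoids J ω = All (λ j → ¬ Bad j ω) J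

  avoids? : ∀ J ω → Dec (Avoids J ω)
  avoids? J ω = All.all? (λ j → ¬? (bad? j ω)) J

  -- Probability for the uniform measure on `ωs` is kept as a count: `q * #bad i J ≤ #avoids J`
  -- expresses that `Bad i`, conditioned on avoiding `J`, has probability at most 1/q.
  #avoids : List I → ℕ
  #avoids J = ∑ ωs λ ω → ⟦ avoids? J ω ⟧

  #bad : I → List I → ℕ
  #bad i J = ∑ ωs λ ω → ⟦ bad? i ω ×-dec avoids? J ω ⟧

  #avoids-∷ : ∀ j J → #avoids J ≤ #avoids (j ∷ J) + #bad j J
  #avoids-∷ j J = subst (#avoids J ≤_) (∑-+ ωs _ _) (∑-mono ωs pointwise)
    where
    pointwise : ∀ ω → ⟦ avoids? J ω ⟧ ≤ ⟦ avoids? (j ∷ J) ω ⟧ + ⟦ bad? j ω ×-dec avoids? J ω ⟧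
    pointwise ω = ⟦⟧-≤ (avoids? J ω) λ av → case av (bad? j ω)
      where
      case : Avoids J ω → Dec (Bad j ω) → 1 ≤ ⟦ avoids? (j ∷ J) ω ⟧ + ⟦ bad? j ω ×-dec avoids? J ω ⟧
      case av (yes b) = ≤-trans (⟦⟧-true (bad? j ω ×-dec avoids? J ω) (b , av)) (m≤n+m _ _)
      case av (no ¬b) = ≤-trans (⟦⟧-true (avoids? (j ∷ J) ω) (¬b ∷ av)) (m≤m+n _ _)

  #bad-anti : ∀ i {J J′} → (∀ {ω} → Avoids J ω → Avoids J′ ω) → #bad i J ≤ #bad i J′
  #bad-anti i {J} {J′} f = ∑-mono ωs λ ω →
    ⟦⟧-mono (bad? i ω ×-dec avoids? J ω) (bad? i ω ×-dec avoids? J′ ω) λ (b , av) → b , f av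

  -- Union bound relative to avoiding `K`: the events of `J` are added one at a time, and each loss
  -- is enlarged by weakening its condition to avoiding `K` alone.
  #avoids-++ : ∀ J K → #avoids K ≤ #avoids (J ++ K) + ∑ J (λ j → #bad j K)
  #avoids-++ []      K = m≤m+n _ 0
  #avoids-++ (j ∷ J) K = begin
    #avoids K                                             ≤⟨ #avoids-++ J K ⟩
    #avoids (J ++ K) + ∑ J (λ j → #bad j K)               ≤⟨ +-monoˡ-≤ _ (#avoids-∷ j (J ++ K)) ⟩
    #avoids (j ∷ J ++ K) + #bad j (J ++ K) + _            ≤⟨ +-monoˡ-≤ _ (+-monoʳ-≤ (#avoids (j ∷ J ++ K)) (#bad-anti j (All.++⁻ʳ J))) ⟩
    #avoids (j ∷ J ++ K) + #bad j K + _                   ≡⟨ +-assoc (#avoids (j ∷ J ++ K)) _ _ ⟩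
    #avoids (j ∷ J ++ K) + (#bad j K + _)                 ∎
    where open ≤-Reasoning

  near far : I → List I → List I
  near i = filter (near? i)
  far  i = filter (¬? ∘ near? i)

  length-near+far : ∀ i J → length (near i J) + length (far i J) ≡ length J
  length-near+far i [] = refl
  length-near+far i (j ∷ J) with near? i j
  ... | yes _ = cong suc (length-near+far i J)
  ... | no  _ = trans (+-suc _ _) (cong suc (length-near+far i J))

  avoids-near-far : ∀ i J {ω} → Avoids (near i J ++ far i J) ω → Avoids J ω
  avoids-near-far i J av = All.filter⁻ (near? i) (All.++⁻ˡ (near i J) av) (All.++⁻ʳ (near i J) av)

  Sparse : ℕ → List I → Set
  Sparse d J = ∀ i → length (near i J) ≤ d

  -- Lets sparsity pass from a family to its far part in the induction below.
  length-near-filter : ∀ {P : I → Set} (P? : Decidable P) i J →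
                       length (near i (filter P? J)) ≤ length (near i J)
  length-near-filter P? i [] = z≤n
  length-near-filter P? i (j ∷ J) with P? j
  length-near-filter P? i (j ∷ J) | yes _ with near? i j
  ... | yes _ = s≤s (length-near-filter P? i J)
  ... | no  _ = length-near-filter P? i J
  length-near-filter P? i (j ∷ J) | no _ with near? i j
  ... | yes _ = m≤n⇒m≤1+n (length-near-filter P? i J)
  ... | no  _ = length-near-filter P? i J

  length-near-∷ : ∀ i j J → length (near i J) ≤ length (near i (j ∷ J))
  length-near-∷ i j J with near? i j
  ... | yes _ = n≤1+n _
  ... | no  _ = ≤-refl

  -- Only one-sided independence is needed: avoiding far events does not make
  -- an event likelier than 1/q.
  module _ {q d : ℕ} (4d≤q : 4 * d ≤ q)
           (indep : ∀ i J → All (λ j → ¬ Near i j) J → q * #bad i J ≤ #avoids J) where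

    ∑-bounded : ∀ (J : List I) f {b} → (∀ j → q * f j ≤ b) → q * ∑ J f ≤ length J * b
    ∑-bounded J f {b} qf≤b = begin
      q * ∑ J f                ≡⟨ ∑-*ˡ J q f ⟨
      ∑ J (λ j → q * f j)      ≤⟨ ∑-mono J qf≤b ⟩
      ∑ J (λ _ → b)            ≡⟨ ∑-const J b ⟩
      length J * b             ∎
      where open ≤-Reasoning

    -- The near part of J is removed at the cost of a factor 2.
    conditional : ∀ n J → length J ≤ n → Sparse d J → ∀ i → q * #bad i J ≤ 2 * #avoids J
    conditional n J len sp i = begin
      q * #bad i J    ≤⟨ *-monoʳ-≤ q (#bad-anti i (All.filter⁺ (¬? ∘ near? i))) ⟩
      q * #bad i F    ≤⟨ indep i F (All.all-filter (¬? ∘ near? i) J) ⟩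
      #avoids F       ≤⟨ half n len ⟩
      2 * #avoids J   ∎
      where
      open ≤-Reasoning
      N = near i J
      F = far i J
      avoids-mono : #avoids (N ++ F) ≤ #avoids J
      avoids-mono = ∑-mono ωs λ ω →
        ⟦⟧-mono (avoids? (N ++ F) ω) (avoids? J ω) (avoids-near-far i J)
      sparse-far : Sparse d F
      sparse-far k = ≤-trans (length-near-filter _ k J) (sp k)
      -- `b` bounds the loss caused by the near events. Doubling the last hypothesis and replacing
      -- `2 * b` by `#avoids F` lets one copy of `#avoids F` cancel.
      absorb : ∀ b → 2 * b ≤ #avoids F → #avoids F ≤ #avoids (N ++ F) + b → #avoids F ≤ 2 * #avoids J
      absorb b 2b≤ h = ≤-trans (+-cancelʳ-≤ (#avoids F) _ _ (begin
        #avoids F + #avoids F                  ≤⟨ +-mono-≤ h h ⟩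
        #avoids (N ++ F) + b + (#avoids (N ++ F) + b)  ≡⟨ rearrange (#avoids (N ++ F)) b ⟩
        2 * #avoids (N ++ F) + 2 * b           ≤⟨ +-monoʳ-≤ (2 * #avoids (N ++ F)) 2b≤ ⟩
        2 * #avoids (N ++ F) + #avoids F       ∎)) (*-monoʳ-≤ 2 avoids-mono)
        where
        rearrange : ∀ x y → x + y + (x + y) ≡ 2 * x + 2 * y
        rearrange = solve-∀
      -- `n` is fuel. If nothing is near `i`, the loss is 0; otherwise `F` is strictly shorter than
      -- `J`, so `conditional` is available for `F`.
      half : ∀ n → length J ≤ n → #avoids F ≤ 2 * #avoids J
      half n len with length N in eq
      ... | zero  = absorb 0 z≤n (subst (λ M → #avoids F ≤ #avoids (M ++ F) + 0) (sym N≡[]) (m≤m+n _ 0))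
        where
        N≡[] : N ≡ []
        N≡[] with N
        N≡[] | [] = refl
      half (suc n) len | suc l = absorb _ bound (#avoids-++ N F)
        where
        shorter : length F ≤ n
        shorter = ≤-pred (≤-trans (s≤s (m≤n+m (length F) l)) (≤-trans (≤-reflexive (trans (cong (_+ length F) (sym eq)) (length-near+far i J))) len))
        1≤d : 1 ≤ d
        1≤d = ≤-trans (≤-trans (s≤s z≤n) (≤-reflexive (sym eq))) (sp i)
        S = ∑ N (λ j → #bad j F)
        -- By induction each near `j` has `q * #bad j F ≤ 2 * #avoids F`. There are at most `d` of
        -- them, and `4 * d ≤ q` brings the total down to half of `#avoids F`.
        bound : 2 * S ≤ #avoids F
        bound = *-cancelˡ-≤ (2 * d) {{>-nonZero (*-mono-≤ {1} {2} (s≤s z≤n) 1≤d)}} (begin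
          2 * d * (2 * S)                  ≡⟨ regroup₂ d S ⟩
          4 * d * S                        ≤⟨ *-monoˡ-≤ S 4d≤q ⟩
          q * S                            ≤⟨ ∑-bounded N (λ j → #bad j F) (conditional n F shorter sparse-far) ⟩
          length N * (2 * #avoids F)       ≤⟨ *-monoˡ-≤ (2 * #avoids F) (sp i) ⟩
          d * (2 * #avoids F)              ≡⟨ regroup d (#avoids F) ⟩
          2 * d * #avoids F                ∎)
          where
          regroup₂ : ∀ d x → 2 * d * (2 * x) ≡ 4 * d * x
          regroup₂ = solve-∀
          regroup : ∀ d x → d * (2 * x) ≡ 2 * d * x
          regroup = solve-∀
      half zero len | suc l = contradiction
        (≤-trans (≤-trans (≤-reflexive (sym eq)) (m≤m+n (length N) (length F))) (≤-trans (≤-reflexive (length-near+far i J)) len))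
        λ ()

    -- If no outcome avoiding `J` also avoided `j`, all of them would be bad for `j`, and `3 *
    -- #avoids J ≤ q * #bad j J ≤ 2 * #avoids J` would contradict the positivity known for `J`.
    #avoids-positive : 3 ≤ q → 0 < length ωs → ∀ J → Sparse d J → 0 < #avoids J
    #avoids-positive 3≤q 0<ωs []      sp = subst (0 <_) (sym (trans (∑-const ωs 1) (*-identityʳ _))) 0<ωs
    #avoids-positive 3≤q 0<ωs (j ∷ J) sp = ≰⇒> λ zero′ → <⇒≱ pos (collapse (≤-trans (#avoids-∷ j J) (+-monoˡ-≤ _ zero′)))
      where
      open ≤-Reasoning
      spJ : Sparse d J
      spJ i = ≤-trans (length-near-∷ i j J) (sp i)
      pos : 0 < #avoids J
      pos = #avoids-positive 3≤q 0<ωs J spJ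
      collapse : #avoids J ≤ #bad j J → #avoids J ≤ 0
      collapse h = +-cancelʳ-≤ (2 * #avoids J) _ _ (begin
        #avoids J + 2 * #avoids J   ≤⟨ *-monoˡ-≤ (#avoids J) 3≤q ⟩
        q * #avoids J               ≤⟨ *-monoʳ-≤ q h ⟩
        q * #bad j J                ≤⟨ conditional (length J) J ≤-refl spJ j ⟩
        2 * #avoids J               ∎)

    local-lemma : 3 ≤ q → 0 < length ωs → ∀ J → Sparse d J → ∃ (Avoids J)
    local-lemma 3≤q 0<ωs J sp with ∑-witness ωs _ (#avoids-positive 3≤q 0<ωs J sp)
    ... | ω , 0<⟦⟧ = ω , ⟦⟧-witness (avoids? J ω) 0<⟦⟧

-- Random labellings

allVecs : List A → ∀ n → List (Vec A n)
allVecs xs zero    = [] ∷ []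
allVecs xs (suc n) = cartesianProductWith _∷_ xs (allVecs xs n)

∈-allVecs : ∀ {xs : List A} → (∀ x → x ∈ xs) → ∀ {n} (v : Vec A n) → v ∈ allVecs xs n
∈-allVecs all []      = here refl
∈-allVecs all (x ∷ v) = ∈-cartesianProductWith⁺ _∷_ (all x) (∈-allVecs all v)

-- Fubini: the sums are compared on each fibre where only coordinate `a` varies, and the fibres are
-- then added up. The element `x₀` only fills the coordinate that the update overwrites.
∑-resample : ∀ (xs : List A) → A → ∀ {n} (f g : Vec A n → ℕ) a →
             (∀ h → ∑ xs (λ x → f (h [ a ]≔ x)) ≤ ∑ xs (λ x → g (h [ a ]≔ x))) →
             ∑ (allVecs xs n) f ≤ ∑ (allVecs xs n) g
∑-resample xs x₀ {suc n} f g zero f≤g = begin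
  ∑ (allVecs xs (suc n)) f                       ≡⟨ ∑-cartesianProductWith _∷_ xs hs f ⟩
  ∑ xs (λ x → ∑ hs (λ h → f (x ∷ h)))           ≡⟨ ∑-swap xs hs (λ x h → f (x ∷ h)) ⟩
  ∑ hs (λ h → ∑ xs (λ x → f (x ∷ h)))           ≤⟨ ∑-mono hs (λ h → f≤g (x₀ ∷ h)) ⟩
  ∑ hs (λ h → ∑ xs (λ x → g (x ∷ h)))           ≡⟨ ∑-swap xs hs (λ x h → g (x ∷ h)) ⟨
  ∑ xs (λ x → ∑ hs (λ h → g (x ∷ h)))           ≡⟨ ∑-cartesianProductWith _∷_ xs hs g ⟨
  ∑ (allVecs xs (suc n)) g                       ∎
  where
  open ≤-Reasoning
  hs = allVecs xs n
∑-resample xs x₀ {suc n} f g (suc a) f≤g = begin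
  ∑ (allVecs xs (suc n)) f               ≡⟨ ∑-cartesianProductWith _∷_ xs hs f ⟩
  ∑ xs (λ x → ∑ hs (λ h → f (x ∷ h)))   ≤⟨ ∑-mono xs (λ x → ∑-resample xs x₀ (f ∘ (x ∷_)) (g ∘ (x ∷_)) a (f≤g ∘ (x ∷_))) ⟩
  ∑ xs (λ x → ∑ hs (λ h → g (x ∷ h)))   ≡⟨ ∑-cartesianProductWith _∷_ xs hs g ⟨
  ∑ (allVecs xs (suc n)) g               ∎
  where
  open ≤-Reasoning
  hs = allVecs xs n

∑-≡-unique : ∀ {k} (b : Fin k) {ys} → Unique ys → ∑ ys (λ y → ⟦ y Fin.≟ b ⟧) ≤ 1
∑-≡-unique b [] = z≤n
∑-≡-unique b (_∷_ {x = y} {xs = ys} y∉ys uniq) with y Fin.≟ b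
... | no _     = ∑-≡-unique b uniq
... | yes refl = s≤s (≤-reflexive (none y∉ys))
  where
  none : ∀ {zs} → All (b ≢_) zs → ∑ zs (λ y → ⟦ y Fin.≟ b ⟧) ≡ 0
  none [] = refl
  none (_∷_ {x = z} b≢z all) with z Fin.≟ b
  ... | yes refl = contradiction refl b≢z
  ... | no _     = none all

_∈?_ : ∀ {k} (x : Fin k) B → Dec (x ∈ B)
x ∈? B = Any.any? (x Fin.≟_) B

∑-∈-≤-length : ∀ {k} (B : List (Fin k)) → ∑ (allFin k) (λ y → ⟦ y ∈? B ⟧) ≤ length B
∑-∈-≤-length {k} B = begin
  ∑ (allFin k) (λ y → ⟦ y ∈? B ⟧)                       ≤⟨ ∑-mono (allFin k) (λ y → ⟦⟧-≤ (y ∈? B) λ y∈B →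
                                                             ≤-trans (⟦⟧-true (y Fin.≟ y) refl) (∈⇒≤∑ (λ b → ⟦ y Fin.≟ b ⟧) y∈B)) ⟩
  ∑ (allFin k) (λ y → ∑ B (λ b → ⟦ y Fin.≟ b ⟧))        ≡⟨ ∑-swap (allFin k) B (λ y b → ⟦ y Fin.≟ b ⟧) ⟩
  ∑ B (λ b → ∑ (allFin k) (λ y → ⟦ y Fin.≟ b ⟧))        ≤⟨ ∑-mono B (λ b → ∑-≡-unique b (allFin⁺ k)) ⟩
  ∑ B (λ _ → 1)                                          ≡⟨ trans (∑-const B 1) (*-identityʳ _) ⟩
  length B                                               ∎
  where open ≤-Reasoning

Within : ∀ {k T} → (Fin T → List (Fin k)) → Vec (Fin k) T → Set
Within B x = ∀ t → lookup x t ∈ B t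

within? : ∀ {k T} (B : Fin T → List (Fin k)) x → Dec (Within B x)
within? B x = Fin.all? λ t → lookup x t ∈? B t

∑-within : ∀ {k s} → 2 * s ≤ k → ∀ T (B : Fin T → List (Fin k)) → (∀ t → length (B t) ≤ s) →
           2 ^ T * ∑ (allVecs (allFin k) T) (λ x → ⟦ within? B x ⟧) ≤ ∑ (allVecs (allFin k) T) (λ _ → 1)
∑-within 2s≤k zero B small = ≤-trans (≤-reflexive (+-identityʳ _)) (∑-mono ([] ∷ []) λ x → ⟦⟧-≤ (within? B x) λ _ → ≤-refl)
∑-within {k} {s} 2s≤k (suc T) B small = begin
  2 ^ suc T * ∑ (allVecs ks (suc T)) (λ x → ⟦ within? B x ⟧)
    ≡⟨ cong (2 ^ suc T *_) (∑-cartesianProductWith _∷_ ks xs _) ⟩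
  2 ^ suc T * ∑ ks (λ y → ∑ xs (λ x → ⟦ within? B (y ∷ x) ⟧))
    ≤⟨ *-monoʳ-≤ (2 ^ suc T) (∑-mono ks λ y → ≤-trans (∑-mono xs (split y)) (≤-reflexive (∑-*ˡ xs ⟦ y ∈? B zero ⟧ _))) ⟩
  2 ^ suc T * ∑ ks (λ y → ⟦ y ∈? B zero ⟧ * W)
    ≡⟨ cong (2 ^ suc T *_) (∑-*ʳ ks W _) ⟩
  2 ^ suc T * (∑ ks (λ y → ⟦ y ∈? B zero ⟧) * W)
    ≤⟨ *-monoʳ-≤ (2 ^ suc T) (*-monoˡ-≤ W (≤-trans (∑-∈-≤-length (B zero)) (small zero))) ⟩
  2 ^ suc T * (s * W)
    ≡⟨ regroup (2 ^ T) s W ⟩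
  2 * s * (2 ^ T * W)
    ≤⟨ *-mono-≤ 2s≤k (∑-within 2s≤k T (B ∘ suc) (small ∘ suc)) ⟩
  k * ∑ xs (λ _ → 1)
    ≡⟨ cong (_* ∑ xs (λ _ → 1)) (length-tabulate {n = k} id) ⟨
  length ks * ∑ xs (λ _ → 1)
    ≡⟨ ∑-const ks _ ⟨
  ∑ ks (λ _ → ∑ xs (λ _ → 1))
    ≡⟨ ∑-cartesianProductWith _∷_ ks xs (λ _ → 1) ⟨
  ∑ (allVecs ks (suc T)) (λ _ → 1) ∎
  where
  open ≤-Reasoning
  ks = allFin k
  xs = allVecs ks T
  W = ∑ xs (λ x → ⟦ within? (B ∘ suc) x ⟧)
  split : ∀ y x → ⟦ within? B (y ∷ x) ⟧ ≤ ⟦ y ∈? B zero ⟧ * ⟦ within? (B ∘ suc) x ⟧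
  split y x = ⟦⟧-≤ (within? B (y ∷ x)) λ w →
    *-mono-≤ (⟦⟧-true (y ∈? B zero) (w zero)) (⟦⟧-true (within? (B ∘ suc) x) (w ∘ suc))
  regroup : ∀ p s w → 2 * p * (s * w) ≡ 2 * s * (p * w)
  regroup = solve-∀

-- The local lemma applied to random label vectors

module Hashing
  {n k T s d : ℕ} {I : Set}
  (centre : I → Fin n) (blockers : I → List (Fin n))
  (centre∉blockers : ∀ i → All (_≢ centre i) (blockers i))
  (few-blockers : ∀ i → length (blockers i) ≤ s)
  where

  Hash : Set
  Hash = Vec (Vec (Fin k) T) n

  Collide : Hash → Fin n → Fin T → Fin n → Set
  Collide h v t x = lookup (lookup h v) t ≡ lookup (lookup h x) t

  Blocked : I → Hash → Set
  Blocked i h = ∀ t → Any (Collide h (centre i) t) (blockers i)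

  blocked? : ∀ i h → Dec (Blocked i h)
  blocked? i h = Fin.all? λ t → Any.any? (λ x → lookup (lookup h (centre i)) t Fin.≟ lookup (lookup h x) t) (blockers i)

  -- The vertices on which Blocked i depends; none if i has no blockers.
  Involves : Fin n → I → Set
  Involves v i = Any (λ x → v ≡ centre i ⊎ v ≡ x) (blockers i)

  involves? : ∀ v i → Dec (Involves v i)
  involves? v i = Any.any? (λ x → (v Fin.≟ centre i) ⊎-dec (v Fin.≟ x)) (blockers i)

  blocked-update : ∀ {v i} → ¬ Involves v i → ∀ h y z → Blocked i (h [ v ]≔ y) → Blocked i (h [ v ]≔ z)
  blocked-update {v} {i} ¬inv h y z b t = go (blockers i) ¬inv (b t)
    where
    same : ∀ w → v ≢ w → lookup (h [ v ]≔ y) w ≡ lookup (h [ v ]≔ z) w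
    same w v≢w = trans (lookup∘update′ (v≢w ∘ sym) h y) (sym (lookup∘update′ (v≢w ∘ sym) h z))
    go : ∀ xs → ¬ Any (λ x → v ≡ centre i ⊎ v ≡ x) xs →
         Any (Collide (h [ v ]≔ y) (centre i) t) xs → Any (Collide (h [ v ]≔ z) (centre i) t) xs
    go (x ∷ xs) ¬any (here eq) = here (trans (cong (λ u → lookup u t) (sym (same (centre i) (¬any ∘ here ∘ inj₁))))
                                   (trans eq (cong (λ u → lookup u t) (same x (¬any ∘ here ∘ inj₂)))))
    go (x ∷ xs) ¬any (there c) = there (go xs (¬any ∘ there) c)

  labels = allVecs (allFin k) T

  open LocalLemma (allVecs labels n) blocked? (λ i → involves? (centre i))

  module _ (2s≤k : 2 * s ≤ k) (c₀ : Fin k) where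

    x₀ : Vec (Fin k) T
    x₀ = replicate T c₀

    -- Only the vector of `a = centre i` is resampled. Avoiding `J` is constant on such a fibre,
    -- since no event of `J` involves `a`. The blockers differ from `a` and keep their labels, so
    -- `Blocked i` confines each new coordinate to at most `s` labels, and `∑-within` applies.
    independent : ∀ i J → All (λ j → ¬ Involves (centre i) j) J → 2 ^ T * #bad i J ≤ #avoids J
    independent i J far-J = subst (_≤ #avoids J) (∑-*ˡ (allVecs labels n) (2 ^ T) _)
      (∑-resample labels x₀ _ _ a λ h → ≤-trans (≤-reflexive (∑-*ˡ labels (2 ^ T) _)) (fibre h (avoids? J (h [ a ]≔ x₀))))
      where
      open ≤-Reasoning
      a = centre i
      move : ∀ h y z → Avoids J (h [ a ]≔ y) → Avoids J (h [ a ]≔ z)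
      move h y z av = All.zipWith (λ (¬inv , ¬b) → ¬b ∘ blocked-update ¬inv h z y) (far-J , av)
      hits : Hash → Fin T → List (Fin k)
      hits h t = map (λ x → lookup (lookup h x) t) (blockers i)
      blocked⇒within : ∀ h y → Blocked i (h [ a ]≔ y) → Within (hits h) y
      blocked⇒within h y b t = Any.map⁺ (go (centre∉blockers i) (b t))
        where
        go : ∀ {xs} → All (_≢ a) xs → Any (Collide (h [ a ]≔ y) a t) xs → Any (λ x → lookup y t ≡ lookup (lookup h x) t) xs
        go (x≢a ∷ _)  (here eq) = here (trans (cong (λ u → lookup u t) (sym (lookup∘update a h y)))
                                    (trans eq (cong (λ u → lookup u t) (lookup∘update′ x≢a h y))))
        go (_ ∷ xs≢a) (there c) = there (go xs≢a c)
      -- The value `x₀` decides for the whole fibre whether `J` is avoided: either every `y` counts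
      -- on the right, or no `y` counts on the left.
      fibre : ∀ h → Dec (Avoids J (h [ a ]≔ x₀)) →
              2 ^ T * ∑ labels (λ y → ⟦ blocked? i (h [ a ]≔ y) ×-dec avoids? J (h [ a ]≔ y) ⟧)
                ≤ ∑ labels (λ y → ⟦ avoids? J (h [ a ]≔ y) ⟧)
      fibre h (yes av) = begin
        2 ^ T * ∑ labels (λ y → ⟦ blocked? i (h [ a ]≔ y) ×-dec avoids? J (h [ a ]≔ y) ⟧)
          ≤⟨ *-monoʳ-≤ (2 ^ T) (∑-mono labels λ y →
               ⟦⟧-mono (blocked? i (h [ a ]≔ y) ×-dec avoids? J (h [ a ]≔ y)) (within? (hits h) y) (blocked⇒within h y ∘ proj₁)) ⟩
        2 ^ T * ∑ labels (λ y → ⟦ within? (hits h) y ⟧)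
          ≤⟨ ∑-within 2s≤k T (hits h) (λ t → ≤-trans (≤-reflexive (length-map _ (blockers i))) (few-blockers i)) ⟩
        ∑ labels (λ _ → 1)
          ≤⟨ ∑-mono labels (λ y → ⟦⟧-true (avoids? J (h [ a ]≔ y)) (move h x₀ y av)) ⟩
        ∑ labels (λ y → ⟦ avoids? J (h [ a ]≔ y) ⟧) ∎
      fibre h (no ¬av) = begin
        2 ^ T * ∑ labels (λ y → ⟦ blocked? i (h [ a ]≔ y) ×-dec avoids? J (h [ a ]≔ y) ⟧)
          ≤⟨ *-monoʳ-≤ (2 ^ T) (∑-mono labels λ y → ⟦⟧-≤ (blocked? i (h [ a ]≔ y) ×-dec avoids? J (h [ a ]≔ y))
               λ (_ , av) → contradiction (move h y x₀ av) ¬av) ⟩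
        2 ^ T * ∑ labels (λ _ → 0)
          ≡⟨ cong (2 ^ T *_) (trans (∑-const labels 0) (*-zeroʳ (length labels))) ⟩
        2 ^ T * 0
          ≡⟨ *-zeroʳ (2 ^ T) ⟩
        0
          ≤⟨ z≤n ⟩
        ∑ labels (λ y → ⟦ avoids? J (h [ a ]≔ y) ⟧) ∎

    nonEmpty : 0 < length (allVecs labels n)
    nonEmpty = Any⇒0< (∈-allVecs (∈-allVecs ∈-allFin) (replicate n x₀))
      where
      Any⇒0< : ∀ {xs : List Hash} {x} → x ∈ xs → 0 < length xs
      Any⇒0< (here _)  = s≤s z≤n
      Any⇒0< (there _) = s≤s z≤n

    -- The local lemma with `q = 2 ^ T`, where `j` is near `i` when `j` involves the resampled
    -- vertex `centre i`. Since `T` is finite and collisions are decidable, not being blocked yields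
    -- an explicit level `t`.
    unblocked-hash : 4 * d ≤ 2 ^ T → 3 ≤ 2 ^ T → ∀ J → (∀ v → length (filter (involves? v) J) ≤ d) →
                     ∃ λ h → All (λ i → ∃ λ t → ¬ Any (Collide h (centre i) t) (blockers i)) J
    unblocked-hash 4d≤q 3≤q J sparse with local-lemma 4d≤q independent 3≤q nonEmpty J (sparse ∘ centre)
    ... | h , av = h , All.map (λ {i} ¬b → Fin.¬∀⟶∃¬ T _
      (λ t → Any.any? (λ x → lookup (lookup h (centre i)) t Fin.≟ lookup (lookup h x) t) (blockers i)) ¬b) av

-- The size of the palette

frac-≤⁺ : ∀ {a b c d} → a * suc d ≤ c * suc b → mkℚᵘ (+ a) b ℚ.≤ mkℚᵘ (+ c) d
frac-≤⁺ {a} {b} {c} {d} h = *≤* (subst₂ ℤ._≤_ (ℤ.pos-* a (suc d)) (ℤ.pos-* c (suc b)) (ℤ.+≤+ h))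

frac-≤⁻ : ∀ {a b c d} → mkℚᵘ (+ a) b ℚ.≤ mkℚᵘ (+ c) d → a * suc d ≤ c * suc b
frac-≤⁻ {a} {b} {c} {d} (*≤* h) =
  ℤ.drop‿+≤+ (subst₂ ℤ._≤_ (sym (ℤ.pos-* a (suc d))) (sym (ℤ.pos-* c (suc b))) h)

-- An equality of representations, because unnormalised addition keeps the product of the
-- denominators.
frac-+ : ∀ a b c d → mkℚᵘ (+ a) b ℚ.+ mkℚᵘ (+ c) d ≡ mkℚᵘ (+ (a * suc d + c * suc b)) (d + b * suc d)
frac-+ a b c d = cong (λ n → mkℚᵘ n (d + b * suc d))
  (sym (trans (ℤ.pos-+ (a * suc d) _) (cong₂ ℤ._+_ (ℤ.pos-* a (suc d)) (ℤ.pos-* c (suc b)))))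

frac-* : ∀ a b c d → mkℚᵘ (+ a) b ℚ.* mkℚᵘ (+ c) d ≡ mkℚᵘ (+ (a * c)) (d + b * suc d)
frac-* a b c d = cong (λ n → mkℚᵘ n (d + b * suc d)) (sym (ℤ.pos-* a c))

-- The arithmetic–harmonic mean inequality for N+1, …, N+l.
harmonic-≥-AMHM : ∀ N l → mkℚᵘ (+ (2 * l)) (2 * N + l) ℚ.≤ harmonic N l
harmonic-≥-AMHM N zero    = frac-≤⁺ z≤n
harmonic-≥-AMHM N (suc l) = ℚ.≤-trans
  -- `l * l + l` is the surplus, after cross-multiplication, in 2(l+1)/(2N+l+2) ≤ 1/(N+1) +
  -- 2l/(2N+l+3).
  (ℚ.≤-trans (frac-≤⁺ (≤-trans (m≤m+n _ (l * l + l)) (≤-reflexive (identity N l))))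
             (ℚ.≤-reflexive (ℚ.≃-reflexive (sym (frac-+ 1 N (2 * l) (2 * suc N + l))))))
  (ℚ.+-monoʳ-≤ 1/[1+ N ] (harmonic-≥-AMHM (suc N) l))
  where
  identity : ∀ N l → 2 * suc l * suc (2 * suc N + l + N * suc (2 * suc N + l)) + (l * l + l)
                   ≡ (1 * suc (2 * suc N + l) + 2 * l * suc N) * suc (2 * N + suc l)
  identity = solve-∀

-- The mean inequality gives 2N/(3N+1), which is at least 5/8 exactly when N ≥ 5. The fraction 5/8
-- is the rational stand-in for ln 2.
harmonic-double-≥ : ∀ N → 5 ≤ N → mkℚᵘ (+ 5) 7 ℚ.≤ harmonic N N
harmonic-double-≥ N 5≤N = ℚ.≤-trans (frac-≤⁺ bound) (harmonic-≥-AMHM N N)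
  where
  lhs : ∀ N → 5 * suc (2 * N + N) ≡ 5 + 15 * N
  lhs = solve-∀
  rhs : ∀ N → N + 15 * N ≡ 2 * N * 8
  rhs = solve-∀
  bound : 5 * suc (2 * N + N) ≤ 2 * N * 8
  bound = ≤-trans (≤-reflexive (lhs N)) (≤-trans (+-monoˡ-≤ (15 * N) 5≤N) (≤-reflexive (rhs N)))

-- The range from N to 2^L N splits into `L` dyadic blocks, each worth at least 5/8; the recursion
-- passes from `N` to `N + N`.
harmonic-2^-≥ : ∀ L N l → 5 ≤ N → 2 ^ L * N ≤ N + l → mkℚᵘ (+ (5 * L)) 7 ℚ.≤ harmonic N l
harmonic-2^-≥ zero    N l 5≤N _ = ℚ.≤-trans (frac-≤⁺ z≤n) (harmonic-≥-AMHM N l)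
harmonic-2^-≥ (suc L) N l 5≤N h with m≤n⇒∃[o]m+o≡n N≤l
  where
  open ≤-Reasoning
  N≤l : N ≤ l
  N≤l = +-cancelˡ-≤ N N l (begin
    N + N            ≡⟨ cong (_+_ N) (+-identityʳ N) ⟨
    2 * N            ≤⟨ *-monoˡ-≤ N (*-monoʳ-≤ 2 (m^n>0 2 L)) ⟩
    2 ^ suc L * N    ≤⟨ h ⟩
    N + l            ∎)
... | l′ , refl = begin
  mkℚᵘ (+ (5 * suc L)) 7                        ≤⟨ frac-≤⁺ (≤-reflexive (identity L)) ⟩
  mkℚᵘ (+ (5 * 8 + 5 * L * 8)) (7 + 7 * 8)      ≡⟨ frac-+ 5 7 (5 * L) 7 ⟨
  mkℚᵘ (+ 5) 7 ℚ.+ mkℚᵘ (+ (5 * L)) 7           ≤⟨ ℚ.+-mono-≤ (harmonic-double-≥ N 5≤N)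
                                                     (harmonic-2^-≥ L (N + N) l′ (≤-trans 5≤N (m≤m+n N N)) h′) ⟩
  harmonic N N ℚ.+ harmonic (N + N) l′          ≃⟨ harmonic-+ N N l′ ⟨
  harmonic N (N + l′)                           ∎
  where
  open ℚ.≤-Reasoning
  identity : ∀ L → 5 * suc L * suc (7 + 7 * 8) ≡ (5 * 8 + 5 * L * 8) * 8
  identity = solve-∀
  double : ∀ p N → p * (N + N) ≡ 2 * p * N
  double = solve-∀
  h′ : 2 ^ L * (N + N) ≤ N + N + l′
  h′ = ≤-trans (≤-reflexive (double (2 ^ L) N)) (≤-trans h (≤-reflexive (sym (+-assoc N N l′))))

-- Only the 0-th approximation is used, which costs the additive 2.
ceiling-≥ : ∀ Δ L m → 1 ≤ Δ → 2 ^ L ≤ Δ → IsCeiling ((27 * Δ) · ln Δ) (+ m) →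
            27 * Δ * (5 * L) ≤ (m + 2) * 8
ceiling-≥ Δ@(suc p) L m _ 2^L≤Δ (27ΔlnΔ≤m , _) = ≤-trans (≤-reflexive (sym (*-identityʳ _)))
  (≤-trans (frac-≤⁻ (begin
    mkℚᵘ (+ (27 * Δ * (5 * L))) 7                 ≡⟨ frac-* (27 * Δ) 0 (5 * L) 7 ⟨
    fromℤᵘ (+ (27 * Δ)) ℚ.* mkℚᵘ (+ (5 * L)) 7    ≤⟨ ℚ.*-monoʳ-≤-nonNeg (fromℤᵘ (+ (27 * Δ)))
                                                       (harmonic-2^-≥ L N (p * N) 5≤N (*-monoˡ-≤ N 2^L≤Δ)) ⟩
    approx ((27 * Δ) · ln Δ) 0                    ≤⟨ 27ΔlnΔ≤m 0 ⟩
    fromℤᵘ (+ m) ℚ.+ mkℚᵘ (+ 2) 0                 ≡⟨ frac-+ m 0 2 0 ⟩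
    mkℚᵘ (+ (m * 1 + 2)) 0                        ∎))
  (≤-reflexive (cong (λ n → (n + 2) * 8) (*-identityʳ m))))
  where
  open ℚ.≤-Reasoning
  -- Scaling by `27 * Δ` reads `ln Δ` at index `27 * Δ * 1`, so the 0-th approximation involves the
  -- reciprocals of the integers above `N` up to `Δ * N`.
  N = suc (27 * Δ * 1)
  5≤N : 5 ≤ N
  5≤N = s≤s (≤-trans (≤-trans (m≤m+n 4 23) (*-monoʳ-≤ 27 {1} {Δ} (s≤s z≤n))) (≤-reflexive (sym (*-identityʳ (27 * Δ)))))

floor-log₂ : ∀ n → 1 ≤ n → ∃ λ L → 2 ^ L ≤ n × n < 2 ^ suc L
floor-log₂ (suc zero)    _ = 0 , ≤-refl , ≤-refl
floor-log₂ (suc (suc n)) _ with floor-log₂ (suc n) (s≤s z≤n)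
... | L , lo , hi with suc (suc n) <? 2 ^ suc L
...   | yes hi′ = L , m≤n⇒m≤1+n lo , hi′
...   | no ¬hi  = suc L , ≮⇒≥ ¬hi , <-≤-trans (s≤s hi) (+-mono-≤ (m^n>0 2 (suc L)) (≤-reflexive (sym (+-identityʳ _))))

-- The 16 is 8 times the additive 2 of `ceiling-≥`. For L ≥ 2 the difference of the sides is a
-- polynomial in `D` and L - 2 with nonnegative coefficients. The upper bound on `suc D` rules out L
-- = 0 and leaves only Δ = 2 and Δ = 3 for L = 1; the constant 27 is nearly tight at Δ = 3, where 5
-- remains.
palette-estimate : ∀ D L → 1 ≤ D → suc D < 2 ^ suc L → (4 + 2 * L) * (4 * D) * 8 + 16 ≤ 27 * suc D * (5 * L)
palette-estimate (suc D)             zero          _ (s≤s (s≤s ()))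
palette-estimate (suc zero)          (suc zero)    _ _ = m≤m+n 208 62
palette-estimate (suc (suc zero))    (suc zero)    _ _ = m≤m+n 400 5
palette-estimate (suc (suc (suc D))) (suc zero)    _ (s≤s (s≤s (s≤s (s≤s ()))))
palette-estimate D                   (suc (suc L)) _ _ =
  ≤-trans (m≤m+n _ (71 * D * L + 14 * D + 135 * L + 254)) (≤-reflexive (identity D L))
  where
  identity : ∀ D L → (4 + 2 * (2 + L)) * (4 * D) * 8 + 16 + (71 * D * L + 14 * D + 135 * L + 254)
                   ≡ 27 * suc D * (5 * (2 + L))
  identity = solve-∀

palette-≤-ceiling : ∀ D L m → 1 ≤ D → 2 ^ L ≤ suc D → suc D < 2 ^ suc L →
                    IsCeiling ((27 * suc D) · ln (suc D)) (+ m) → (4 + 2 * L) * (4 * D) ≤ m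
palette-≤-ceiling D L m 1≤D lo hi ceil = *-cancelʳ-≤ _ m 8 (+-cancelʳ-≤ 16 _ _ (begin
  (4 + 2 * L) * (4 * D) * 8 + 16   ≤⟨ palette-estimate D L 1≤D hi ⟩
  27 * suc D * (5 * L)             ≤⟨ ceiling-≥ (suc D) L m (s≤s z≤n) lo ceil ⟩
  (m + 2) * 8                      ≡⟨ *-distribʳ-+ 8 m 2 ⟩
  m * 8 + 16                       ∎))
  where
  open ≤-Reasoning

-- Graphs

module _ (G : Graph) where
  open Graph G

  ~-sym : ∀ {u v} → u ~ v → v ~ u
  ~-sym {u} {v} = subst T (adj-sym u v)

  _~?_ : ∀ u v → Dec (u ~ v)
  u ~? v = T? (adj u v)

  vertices : List V
  vertices = allFin order

  degree-∑ : ∀ u → degree u ≡ ∑ vertices (λ v → ⟦ u ~? v ⟧)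
  degree-∑ u = length-filter-∑ (u ~?_) vertices

  degree≤maxDegree : ∀ u → degree u ≤ maxDegree
  degree≤maxDegree u = All.lookup (xs≤max 0 (map degree vertices)) (∈-map⁺ degree (∈-allFin u))

  -- Separating labellings for the edges between two disjoint vertex sets

  module Stars
    {A L : V → Set} (A? : Decidable A) (L? : Decidable L) (A∩L=∅ : ∀ {v} → A v → ¬ L v)
    {D : ℕ} (deg≤ : ∀ v → degree v ≤ suc D)
    where

    Ray : V × V → Set
    Ray (a , b) = A a × L b × a ~ b

    ray? : Decidable Ray
    ray? (a , b) = A? a ×-dec L? b ×-dec a ~? b

    -- The events are indexed by all of `V × V`. Including `Ray` here gives every other pair an
    -- empty blocker list, so that it involves no vertex.
    Blocks : V × V → V → Set
    Blocks (a , b) x = Ray (a , b) × A x × x ≢ a × (a ~ x ⊎ b ~ x)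

    blocks? : ∀ p → Decidable (Blocks p)
    blocks? (a , b) x = ray? (a , b) ×-dec A? x ×-dec ¬? (x Fin.≟ a) ×-dec (a ~? x ⊎-dec b ~? x)

    blockers : V × V → List V
    blockers p = filter (blocks? p) vertices

    others-≤ : ∀ {a b} → a ~ b → ∑ vertices (λ x → ⟦ a ~? x ×-dec ¬? (x Fin.≟ b) ⟧) ≤ D
    others-≤ {a} {b} a~b = ≤-pred (begin
      suc (∑ vertices other)                                ≤⟨ +-monoˡ-≤ (∑ vertices other) (≤-trans (⟦⟧-true (b Fin.≟ b) refl) (∈⇒≤∑ (λ x → ⟦ x Fin.≟ b ⟧) (∈-allFin b))) ⟩
      ∑ vertices (λ x → ⟦ x Fin.≟ b ⟧) + ∑ vertices other   ≡⟨ ∑-+ vertices _ other ⟨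
      ∑ vertices (λ x → ⟦ x Fin.≟ b ⟧ + other x)            ≤⟨ ∑-mono vertices split ⟩
      ∑ vertices (λ x → ⟦ a ~? x ⟧)                         ≡⟨ degree-∑ a ⟨
      degree a                                              ≤⟨ deg≤ a ⟩
      suc D                                                 ∎)
      where
      open ≤-Reasoning
      other : V → ℕ
      other x = ⟦ a ~? x ×-dec ¬? (x Fin.≟ b) ⟧
      split : ∀ x → ⟦ x Fin.≟ b ⟧ + other x ≤ ⟦ a ~? x ⟧
      split x with x Fin.≟ b
      ... | yes refl = ≤-trans (s≤s (⟦⟧-≤ (a ~? x ×-dec no _) λ (_ , x≢x) → contradiction refl x≢x)) (⟦⟧-true (a ~? x) a~b)
      ... | no x≢b   = ⟦⟧-mono (a ~? x ×-dec yes x≢b) (a ~? x) proj₁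

    -- A blocker adjacent to `a` is not `b`, because `A` and `L` are disjoint, and one adjacent to
    -- `b` is not `a` by definition. Each end thus contributes at most `D` neighbours.
    few-blockers : ∀ p → length (blockers p) ≤ 2 * D
    few-blockers p@(a , b) = subst (_≤ 2 * D) (sym (length-filter-∑ (blocks? p) vertices)) (bound (ray? p))
      where
      open ≤-Reasoning
      bound : Dec (Ray p) → ∑ vertices (λ x → ⟦ blocks? p x ⟧) ≤ 2 * D
      bound (no ¬ray) = begin
        ∑ vertices (λ x → ⟦ blocks? p x ⟧)   ≤⟨ ∑-mono vertices (λ x → ⟦⟧-≤ (blocks? p x) λ (ray , _) → contradiction ray ¬ray) ⟩
        ∑ vertices (λ _ → 0)                 ≡⟨ trans (∑-const vertices 0) (*-zeroʳ (length vertices)) ⟩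
        0                                    ≤⟨ z≤n ⟩
        2 * D                                ∎
      bound (yes (_ , Lb , a~b)) = begin
        ∑ vertices (λ x → ⟦ blocks? p x ⟧)                  ≤⟨ ∑-mono vertices split ⟩
        ∑ vertices (λ x → at-a x + at-b x)                  ≡⟨ ∑-+ vertices at-a at-b ⟩
        ∑ vertices at-a + ∑ vertices at-b                   ≤⟨ +-mono-≤ (others-≤ a~b) (≤-trans (others-≤ (~-sym a~b)) (m≤m+n D 0)) ⟩
        2 * D                                               ∎
        where
        at-a at-b : V → ℕ
        at-a x = ⟦ a ~? x ×-dec ¬? (x Fin.≟ b) ⟧
        at-b x = ⟦ b ~? x ×-dec ¬? (x Fin.≟ a) ⟧
        split : ∀ x → ⟦ blocks? p x ⟧ ≤ at-a x + at-b x
        split x = ⟦⟧-≤ (blocks? p x) λ where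
          (_ , Ax , _ , inj₁ a~x) → ≤-trans
            (⟦⟧-true (a ~? x ×-dec ¬? (x Fin.≟ b)) (a~x , λ { refl → A∩L=∅ Ax Lb })) (m≤m+n (at-a x) _)
          (_ , _ , x≢a , inj₂ b~x) → ≤-trans
            (⟦⟧-true (b ~? x ×-dec ¬? (x Fin.≟ a)) (b~x , x≢a)) (m≤n+m (at-b x) (at-a x))

    pairs : List (V × V)
    pairs = cartesianProduct vertices vertices

    module _ {k T : ℕ} where

      open Hashing {k = k} {T = T} {s = 2 * D} {d = suc D * suc D} proj₁ blockers
        (λ p → All.map (proj₁ ∘ proj₂ ∘ proj₂) (All.all-filter (blocks? p) vertices))
        few-blockers public

      -- A pair involving v has an end w ∈ A ∪ L adjacent to v, and w lies in at
      -- most deg w pairs.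
      few-involving : ∀ v → length (filter (involves? v) pairs) ≤ suc D * suc D
      few-involving v = begin
        length (filter (involves? v) pairs)
          ≡⟨ length-filter-∑ (involves? v) pairs ⟩
        ∑ pairs (λ p → ⟦ involves? v p ⟧)
          ≡⟨ ∑-cartesianProductWith _,_ vertices vertices _ ⟩
        ∑ vertices (λ a → ∑ vertices (λ b → ⟦ involves? v (a , b) ⟧))
          ≤⟨ ∑-mono vertices (λ a → ∑-mono vertices (split a)) ⟩
        ∑ vertices (λ a → ∑ vertices (λ b → inL b * ⟦ b ~? a ⟧ + inA a * ⟦ a ~? b ⟧))
          ≡⟨ trans (∑-cong vertices (λ a → ∑-+ vertices _ _)) (∑-+ vertices _ _) ⟩
        ∑ vertices (λ a → ∑ vertices (λ b → inL b * ⟦ b ~? a ⟧)) + ∑ vertices (λ a → ∑ vertices (λ b → inA a * ⟦ a ~? b ⟧))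
          ≡⟨ cong (_+ ∑ vertices (λ a → ∑ vertices (λ b → inA a * ⟦ a ~? b ⟧))) (∑-swap vertices vertices (λ a b → inL b * ⟦ b ~? a ⟧)) ⟩
        ∑ vertices (λ b → ∑ vertices (λ a → inL b * ⟦ b ~? a ⟧)) + ∑ vertices (λ a → ∑ vertices (λ b → inA a * ⟦ a ~? b ⟧))
          ≤⟨ +-mono-≤ (∑-mono vertices (weigh inL)) (∑-mono vertices (weigh inA)) ⟩
        ∑ vertices (λ b → inL b * suc D) + ∑ vertices (λ a → inA a * suc D)
          ≡⟨ cong₂ _+_ (∑-*ʳ vertices (suc D) inL) (∑-*ʳ vertices (suc D) inA) ⟩
        ∑ vertices inL * suc D + ∑ vertices inA * suc D
          ≡⟨ *-distribʳ-+ (suc D) (∑ vertices inL) (∑ vertices inA) ⟨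
        (∑ vertices inL + ∑ vertices inA) * suc D
          ≡⟨ cong (_* suc D) (∑-+ vertices inL inA) ⟨
        ∑ vertices (λ w → inL w + inA w) * suc D
          ≤⟨ *-monoˡ-≤ (suc D) (∑-mono vertices disjoint) ⟩
        ∑ vertices (λ w → ⟦ v ~? w ⟧) * suc D
          ≡⟨ cong (_* suc D) (degree-∑ v) ⟨
        degree v * suc D
          ≤⟨ *-monoˡ-≤ (suc D) (deg≤ v) ⟩
        suc D * suc D ∎
        where
        open ≤-Reasoning
        inL inA : V → ℕ
        inL w = ⟦ L? w ×-dec v ~? w ⟧
        inA w = ⟦ A? w ×-dec v ~? w ⟧
        weigh : ∀ (f : V → ℕ) w → ∑ vertices (λ u → f w * ⟦ w ~? u ⟧) ≤ f w * suc D
        weigh f w = ≤-trans (≤-reflexive (∑-*ˡ vertices (f w) _))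
                            (*-monoʳ-≤ (f w) (≤-trans (≤-reflexive (sym (degree-∑ w))) (deg≤ w)))
        -- A neighbour of `v` is charged as a leaf or as a centre but never as both, which keeps the
        -- bound at Δ² rather than 2Δ².
        disjoint : ∀ w → inL w + inA w ≤ ⟦ v ~? w ⟧
        disjoint w with L? w
        ... | yes Lw = ≤-trans (+-mono-≤ (⟦⟧-mono (yes Lw ×-dec v ~? w) (v ~? w) proj₂)
                                         (⟦⟧-≤ (A? w ×-dec v ~? w) λ (Aw , _) → contradiction Lw (A∩L=∅ Aw)))
                               (≤-reflexive (+-identityʳ _))
        ... | no ¬Lw = ⟦⟧-mono (A? w ×-dec v ~? w) (v ~? w) proj₂
        leaf-near : ∀ {a b} → L b → v ~ b → b ~ a → 1 ≤ inL b * ⟦ b ~? a ⟧ + inA a * ⟦ a ~? b ⟧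
        leaf-near {a} {b} Lb v~b b~a = ≤-trans
          (*-mono-≤ (⟦⟧-true (L? b ×-dec v ~? b) (Lb , v~b)) (⟦⟧-true (b ~? a) b~a)) (m≤m+n _ _)
        centre-near : ∀ {a b} → A a → v ~ a → a ~ b → 1 ≤ inL b * ⟦ b ~? a ⟧ + inA a * ⟦ a ~? b ⟧
        centre-near {a} {b} Aa v~a a~b = ≤-trans
          (*-mono-≤ (⟦⟧-true (A? a ×-dec v ~? a) (Aa , v~a)) (⟦⟧-true (a ~? b) a~b)) (m≤n+m _ _)
        split : ∀ a b → ⟦ involves? v (a , b) ⟧ ≤ inL b * ⟦ b ~? a ⟧ + inA a * ⟦ a ~? b ⟧
        split a b = ⟦⟧-≤ (involves? v (a , b)) λ inv → case (find inv)
          where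
          case : (∃ λ x → x ∈ blockers (a , b) × (v ≡ a ⊎ v ≡ x)) → _
          -- If `v` is the centre, the end charged is the leaf; if `v` is a blocker, it is the end
          -- to which that blocker is adjacent.
          case (x , x∈ , v≡) with proj₂ (∈-filter⁻ (blocks? (a , b)) {xs = vertices} x∈) | v≡
          ... | (Aa , Lb , a~b) , _                  | inj₁ refl = leaf-near Lb a~b (~-sym a~b)
          ... | (Aa , Lb , a~b) , _ , _ , inj₁ a~x   | inj₂ refl = centre-near Aa (~-sym a~x) a~b
          ... | (Aa , Lb , a~b) , _ , _ , inj₂ b~x   | inj₂ refl = leaf-near Lb (~-sym b~x) (~-sym a~b)

      Separates : Hash → Set
      Separates h = ∀ a b → A a → L b → a ~ b →
        ∃ λ t → ∀ x → A x → x ≢ a → a ~ x ⊎ b ~ x → lookup (lookup h a) t ≢ lookup (lookup h x) t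

      separating-hash : 4 * D ≤ k → Fin k → 4 * (suc D * suc D) ≤ 2 ^ T → ∃ Separates
      separating-hash 4D≤k c₀ 4Δ²≤2^T = proj₁ free , separates
        where
        free = unblocked-hash (≤-trans (≤-reflexive (sym (*-assoc 2 2 D))) 4D≤k) c₀ 4Δ²≤2^T
          (≤-trans (≤-trans (n≤1+n 3) (*-monoʳ-≤ 4 {1} {suc D * suc D} (s≤s z≤n))) 4Δ²≤2^T) pairs few-involving
        separates : Separates (proj₁ free)
        separates a b Aa Lb a~b = proj₁ level , λ x Ax x≢a near eq → proj₂ level
          (lose (∈-filter⁺ (blocks? (a , b)) (∈-allFin x) ((Aa , Lb , a~b) , Ax , x≢a , near)) eq)
          where
          level = All.lookup (proj₂ free) (∈-cartesianProduct⁺ (∈-allFin a) (∈-allFin b))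

  edge-≡ : ∀ {e f} → src e ≡ src f → tgt e ≡ tgt f → e ≡ f
  edge-≡ {edge _ _ p q} {edge _ _ p′ q′} refl refl = cong₂ (edge _ _) (<-irrelevant p p′) (T-irrelevant q q′)

  triangle-~ : ∀ {x y z u v} → IsTriangle x y z → u ≡ x ⊎ u ≡ y ⊎ u ≡ z → v ≡ x ⊎ v ≡ y ⊎ v ≡ z → u ≢ v → u ~ v
  triangle-~ (xy , yz , xz) (inj₁ refl)        (inj₁ refl)        u≢v = contradiction refl u≢v
  triangle-~ (xy , yz , xz) (inj₁ refl)        (inj₂ (inj₁ refl)) u≢v = xy
  triangle-~ (xy , yz , xz) (inj₁ refl)        (inj₂ (inj₂ refl)) u≢v = xz
  triangle-~ (xy , yz , xz) (inj₂ (inj₁ refl)) (inj₁ refl)        u≢v = ~-sym xy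
  triangle-~ (xy , yz , xz) (inj₂ (inj₁ refl)) (inj₂ (inj₁ refl)) u≢v = contradiction refl u≢v
  triangle-~ (xy , yz , xz) (inj₂ (inj₁ refl)) (inj₂ (inj₂ refl)) u≢v = yz
  triangle-~ (xy , yz , xz) (inj₂ (inj₂ refl)) (inj₁ refl)        u≢v = ~-sym xz
  triangle-~ (xy , yz , xz) (inj₂ (inj₂ refl)) (inj₂ (inj₁ refl)) u≢v = ~-sym yz
  triangle-~ (xy , yz , xz) (inj₂ (inj₂ refl)) (inj₂ (inj₂ refl)) u≢v = contradiction refl u≢v

  -- From a proper vertex colouring to an injective edge colouring

  module EdgeColouring {r : ℕ} (c : V → Fin (suc r)) (proper : IsProper c) where

    -- The shift by `suc` matters: the higher-coloured end of an edge never has colour `zero`, so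
    -- `suc r` vertex colours give only `r` groups.
    Below Class : Fin r → V → Set
    Below g v = c v Fin.< suc g
    Class g v = c v ≡ suc g

    record Orientation (e : Edge) : Set where
      field
        centre leaf : V
        group       : Fin r
        below       : Below group centre
        class       : Class group leaf
        joined      : centre ~ leaf
        ends        : (src e ≡ centre × tgt e ≡ leaf) ⊎ (src e ≡ leaf × tgt e ≡ centre)

    module _ {e : Edge} (o : Orientation e) where
      open Orientation o

      centre∈ : centre ∈ₑ e
      centre∈ with ends
      ... | inj₁ (s , _) = inj₁ (sym s)
      ... | inj₂ (_ , t) = inj₂ (sym t)

      leaf∈ : leaf ∈ₑ e
      leaf∈ with ends
      ... | inj₁ (_ , t) = inj₂ (sym t)
      ... | inj₂ (s , _) = inj₁ (sym s)

      ∈-ends : ∀ {x} → x ∈ₑ e → x ≡ centre ⊎ x ≡ leaf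
      ∈-ends x∈e with ends | x∈e
      ... | inj₁ (s , _) | inj₁ x≡ = inj₁ (trans x≡ s)
      ... | inj₁ (_ , t) | inj₂ x≡ = inj₂ (trans x≡ t)
      ... | inj₂ (s , _) | inj₁ x≡ = inj₂ (trans x≡ s)
      ... | inj₂ (_ , t) | inj₂ x≡ = inj₁ (trans x≡ t)

    <⇒suc : ∀ {i j : Fin (suc r)} → i Fin.< j → ∃ λ g → j ≡ suc g
    <⇒suc {j = suc g} _ = g , refl

    orient : ∀ e → Orientation e
    orient e with Fin.<-cmp (c (src e)) (c (tgt e))
    ... | tri≈ _ eq _ = contradiction eq (proper _ _ (adjacent e))
    ... | tri< lt _ _ = record
      { centre = src e ; leaf = tgt e ; group = proj₁ (<⇒suc lt) ; below = subst (c (src e) Fin.<_) (proj₂ (<⇒suc lt)) lt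
      ; class = proj₂ (<⇒suc lt) ; joined = adjacent e ; ends = inj₁ (refl , refl) }
    ... | tri> _ _ gt = record
      { centre = tgt e ; leaf = src e ; group = proj₁ (<⇒suc gt) ; below = subst (c (tgt e) Fin.<_) (proj₂ (<⇒suc gt)) gt
      ; class = proj₂ (<⇒suc gt) ; joined = ~-sym (adjacent e) ; ends = inj₂ (refl , refl) }

    open Orientation

    -- Opposite listings of the same two ends would contradict `src<tgt` for one of the edges.
    orientation-injective : ∀ {e f} (o : Orientation e) (o′ : Orientation f) →
                            centre o ≡ centre o′ → leaf o ≡ leaf o′ → e ≡ f
    orientation-injective {e} {f} o o′ ce le with ends o | ends o′
    ... | inj₁ (s , t) | inj₁ (s′ , t′) = edge-≡ (trans s (trans ce (sym s′))) (trans t (trans le (sym t′)))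
    ... | inj₂ (s , t) | inj₂ (s′ , t′) = edge-≡ (trans s (trans le (sym s′))) (trans t (trans ce (sym t′)))
    ... | inj₁ (s , t) | inj₂ (s′ , t′) = contradiction (src<tgt f)
      (<-asym (subst₂ Fin._<_ (trans s (trans ce (sym t′))) (trans t (trans le (sym s′))) (src<tgt e)))
    ... | inj₂ (s , t) | inj₁ (s′ , t′) = contradiction (src<tgt f)
      (<-asym (subst₂ Fin._<_ (trans s (trans le (sym t′))) (trans t (trans ce (sym s′))) (src<tgt e)))

    Beside : ∀ {e f} → Orientation e → Orientation f → Set
    Beside o o′ = centre o ~ centre o′ ⊎ leaf o ~ centre o′

    same-class-≁ : ∀ {g u v} → Class g u → Class g v → ¬ u ~ v
    same-class-≁ cu cv u~v = proper _ _ u~v (trans cu (sym cv))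

    -- Both leaves lie in one independent class, so an edge joining `e` to `f` meets one of the two
    -- centres. In a common triangle, equal centres would force distinct and hence adjacent leaves;
    -- so the centres are distinct and themselves adjacent.
    conflict⇒beside : ∀ {e f} (o : Orientation e) (o′ : Orientation f) → group o ≡ group o′ →
      e ≢ f → Conflict e f → centre o ≢ centre o′ × (Beside o o′ ⊎ Beside o′ o)
    conflict⇒beside {f = f} o o′ refl e≢f (inj₁ (disjoint , x , y , x∈e , y∈f , x~y)) =
      (λ eq → disjoint (centre o , centre∈ o , subst (_∈ₑ f) (sym eq) (centre∈ o′))) , beside (∈-ends o x∈e) (∈-ends o′ y∈f)
      where
      beside : x ≡ centre o ⊎ x ≡ leaf o → y ≡ centre o′ ⊎ y ≡ leaf o′ → Beside o o′ ⊎ Beside o′ o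
      beside (inj₁ refl) (inj₁ refl) = inj₁ (inj₁ x~y)
      beside (inj₂ refl) (inj₁ refl) = inj₁ (inj₂ x~y)
      beside (inj₁ refl) (inj₂ refl) = inj₂ (inj₂ (~-sym x~y))
      beside (inj₂ refl) (inj₂ refl) = contradiction x~y (same-class-≁ (class o) (class o′))
    conflict⇒beside o o′ refl e≢f (inj₂ (x , y , z , tri , e⊆ , f⊆)) =
      centres≢ , inj₁ (inj₁ (triangle-~ tri (e⊆ _ (centre∈ o)) (f⊆ _ (centre∈ o′)) centres≢))
      where
      centres≢ : centre o ≢ centre o′
      centres≢ ce = same-class-≁ (class o) (class o′)
        (triangle-~ tri (e⊆ _ (leaf∈ o)) (f⊆ _ (leaf∈ o′)) λ le → e≢f (orientation-injective o o′ ce le))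

    module _ {k T : ℕ} (label : Fin r → V → Fin T → Fin k)
      (level : ∀ {e} (o : Orientation e) → ∃ λ t → ∀ x → Below (group o) x → x ≢ centre o →
               centre o ~ x ⊎ leaf o ~ x → label (group o) (centre o) t ≢ label (group o) x t)
      where

      colour : ∀ {e} → Orientation e → Fin (r * (T * k))
      colour o = combine (group o) (combine (proj₁ (level o)) (label (group o) (centre o) (proj₁ (level o))))

      -- Equal colours mean equal group, level and label. One centre lies beside the other edge, and
      -- the level chosen for that edge separates its own centre from exactly such vertices.
      colour-injective : ∀ {e f} (o : Orientation e) (o′ : Orientation f) → e ≢ f → Conflict e f → colour o ≢ colour o′
      colour-injective o o′ e≢f conf eq
        with Fin.combine-injective (group o) _ (group o′) _ eq
      ... | g≡ , eq′ with Fin.combine-injective (proj₁ (level o)) _ (proj₁ (level o′)) _ eq′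
      ... | t≡ , l≡ with conflict⇒beside o o′ g≡ e≢f conf
      ... | a≢a′ , inj₁ beside = proj₂ (level o) (centre o′) (subst (λ g → Below g (centre o′)) (sym g≡) (below o′)) (a≢a′ ∘ sym) beside
              (trans l≡ (cong₂ (λ g t → label g (centre o′) t) (sym g≡) (sym t≡)))
      ... | a≢a′ , inj₂ beside = proj₂ (level o′) (centre o) (subst (λ g → Below g (centre o)) g≡ (below o)) a≢a′ beside
              (trans (sym l≡) (cong₂ (λ g t → label g (centre o) t) g≡ t≡))

    injectivelyEdgeColourable : ∀ {D k T} → (∀ v → degree v ≤ suc D) → 4 * D ≤ k → Fin k →
                                4 * (suc D * suc D) ≤ 2 ^ T → InjectivelyEdgeColourable (r * (T * k))
    injectivelyEdgeColourable {k = k} {T} deg≤ 4D≤k c₀ 4Δ²≤2^T =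
      (λ e → colour label level (orient e)) , λ e f → colour-injective label level (orient e) (orient f)
      where
      module S (g : Fin r) = Stars {A = Below g} {L = Class g} (λ v → c v Fin.<? suc g) (λ v → c v Fin.≟ suc g)
                               (λ v<g v≡g → <⇒≢ v<g (cong Fin.toℕ v≡g)) deg≤
      -- Each group has its own labelling; colours from different groups already differ in their
      -- first component.
      hash : ∀ g → ∃ (S.Separates g {k} {T})
      hash g = S.separating-hash g 4D≤k c₀ 4Δ²≤2^T
      label : Fin r → V → Fin T → Fin k
      label g v t = lookup (lookup (proj₁ (hash g)) v) t
      level : ∀ {e} (o : Orientation e) → ∃ λ t → ∀ x → Below (group o) x → x ≢ centre o →
              centre o ~ x ⊎ leaf o ~ x → label (group o) (centre o) t ≢ label (group o) x t
      level o = proj₂ (hash (group o)) (centre o) (leaf o) (below o) (class o) (joined o)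

  -- Choice of parameters and conclusion

  injectivelyEdgeColourable-mono : ∀ {k l} → k ≤ l → InjectivelyEdgeColourable k → InjectivelyEdgeColourable l
  injectivelyEdgeColourable-mono k≤l (c , inj) =
    (λ e → inject≤ (c e) k≤l) , λ e f e≢f conf eq → inj e f e≢f conf (Fin.inject≤-injective k≤l k≤l _ _ eq)

  -- Formulated for an arbitrary proper colouring with `suc r` colours, so that r = χ - 1 and the
  -- bipartite case r = 1 are both instances. The number of labels is exactly `4 * D`, positive
  -- because Δ ≥ 2.
  injectiveChromaticIndex-≤ : ∀ {Δ r m} → 2 ≤ Δ → maxDegree ≡ Δ → Colourable (suc r) →
    IsCeiling ((27 * Δ) · ln Δ) (+ m) → injectiveChromaticIndex G ≤ r * m
  injectiveChromaticIndex-≤ {suc D@(suc D′)} {r} {m} (s≤s (s≤s z≤n)) maxDegree≡ (c , proper) ceil =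
    proj₂ (injectiveChromaticIndex-isLeast G) (r * m)
    (injectivelyEdgeColourable-mono (*-monoʳ-≤ r (palette-≤-ceiling D L m (s≤s z≤n) lo hi ceil))
      (EdgeColouring.injectivelyEdgeColourable c proper {T = 4 + 2 * L}
        (λ v → subst (degree v ≤_) maxDegree≡ (degree≤maxDegree v)) ≤-refl zero 4Δ²≤2^T))
    where
    open ≤-Reasoning
    L  = proj₁ (floor-log₂ (suc D) (s≤s z≤n))
    lo = proj₁ (proj₂ (floor-log₂ (suc D) (s≤s z≤n)))
    hi = proj₂ (proj₂ (floor-log₂ (suc D) (s≤s z≤n)))
    identity : ∀ p → 4 * (2 * p * (2 * p)) ≡ 16 * (p * p)
    identity = solve-∀
    -- From Δ < 2^{L+1} comes 4Δ² ≤ 4 · 4 · 4^L, which accounts for the 4 in `4 + 2 * L`.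
    4Δ²≤2^T : 4 * (suc D * suc D) ≤ 2 ^ (4 + 2 * L)
    4Δ²≤2^T = begin
      4 * (suc D * suc D)              ≤⟨ *-monoʳ-≤ 4 (*-mono-≤ (<⇒≤ hi) (<⇒≤ hi)) ⟩
      4 * (2 ^ suc L * 2 ^ suc L)      ≡⟨ identity (2 ^ L) ⟩
      16 * (2 ^ L * 2 ^ L)             ≡⟨ cong (16 *_) (^-distribˡ-+-* 2 L L) ⟨
      16 * 2 ^ (L + L)                 ≡⟨ cong (λ n → 16 * 2 ^ (L + n)) (+-identityʳ L) ⟨
      16 * 2 ^ (2 * L)                 ≡⟨ ^-distribˡ-+-* 2 4 (2 * L) ⟨
      2 ^ (4 + 2 * L)                  ∎

bipartite⇒2-colourable : ∀ G → Graph.Bipartite G → Graph.Colourable G 2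
bipartite⇒2-colourable G (side , different) = toFin ∘ side , λ u v u~v eq → different u v u~v (toFin-injective _ _ eq)
  where
  toFin : Bool → Fin 2
  toFin false = zero
  toFin true  = suc zero
  toFin-injective : ∀ a b → toFin a ≡ toFin b → a ≡ b
  toFin-injective false false _ = refl
  toFin-injective true  true  _ = refl

theorem1p6 : ((Δ χ : ℕ) → 2 ≤ χ → χ ≤ Δ →
    (G : Graph) → Graph.maxDegree G ≡ Δ → chromaticNumber G ≡ χ →
    (m : ℕ) → IsCeiling ((27 * Δ) · ln Δ) (+ m) →
    injectiveChromaticIndex G ≤ (χ ∸ 1) * m)
    ×
    ((Δ : ℕ) → 2 ≤ Δ →
    (G : Graph) → Graph.maxDegree G ≡ Δ → Graph.Bipartite G →
    (m : ℕ) → IsCeiling ((27 * Δ) · ln Δ) (+ m) →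
    injectiveChromaticIndex G ≤ m)
theorem1p6 = general , bipartite
  where
  general : ∀ Δ χ → 2 ≤ χ → χ ≤ Δ → ∀ G → Graph.maxDegree G ≡ Δ → chromaticNumber G ≡ χ →
            ∀ m → IsCeiling ((27 * Δ) · ln Δ) (+ m) → injectiveChromaticIndex G ≤ (χ ∸ 1) * m
  general Δ (suc r) 2≤χ χ≤Δ G maxDegree≡ χ≡ m = injectiveChromaticIndex-≤ G (≤-trans 2≤χ χ≤Δ) maxDegree≡
    (subst (Graph.Colourable G) χ≡ (proj₁ (chromaticNumber-isLeast G)))
  bipartite : ∀ Δ → 2 ≤ Δ → ∀ G → Graph.maxDegree G ≡ Δ → Graph.Bipartite G →
              ∀ m → IsCeiling ((27 * Δ) · ln Δ) (+ m) → injectiveChromaticIndex G ≤ m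
  bipartite Δ 2≤Δ G maxDegree≡ bip m ceil = subst (injectiveChromaticIndex G ≤_) (*-identityˡ m)
    (injectiveChromaticIndex-≤ G 2≤Δ maxDegree≡ (bipartite⇒2-colourable G bip) ceil)
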